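{- Let $k,t,j,w$ be fixed integers with $1\le j<t<k$ and $1\le w<k-t$. Put $\alpha=\gamma(w,t,j)-\gamma(k-t,t,j)$ and $\beta=\gamma(w-1,t+1,j)-\gamma(w,t,j)$. Then there is a function $\varepsilon(n)$ with $\varepsilon(n)\to0$ as $n\to\infty$ such that for all sufficiently large $n$ the following holds: if $\mathcal F\subset\binom{[n]}{k}$ is $t$-intersecting and $$|\mathcal F|>\frac{\alpha+\beta+\varepsilon(n)}{\beta}\binom{2k-t}{w+1}\binom{n-2k+t}{k-w-t-1},$$ then $$|\partial^j\mathcal F|\ge\gamma(w,t,j)\,|\mathcal F|.$$
   Context: $[n]=\{1,\dots,n\}$, and $\binom{[n]}{k}$ is the collection of all $k$-element subsets of $[n]$. A family $\mathcal F\subset\binom{[n]}{k}$ is $t$-intersecting if $|F\cap F'|\ge t$ for all $F,F'\in\mathcal F$. The $j$'th shadow is $\partial^j\mathcal F=\{G\in\binom{[n]}{k-j} : \exists F\in\mathcal F,\ G\subset F\}$. For integers $\ell\ge0$, $t\ge j\ge 1$, $$\gamma(\ell,t,j)=\binom{t+2\ell}{t+\ell-j}\Big/\binom{t+2\ell}{t+\ell}.$$ -}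

module Defs where

open import Data.Nat as ℕ using (ℕ; zero; suc; _∸_; _!; NonZero; s≤s)
import Data.Nat.Properties as ℕ
open import Data.Nat.Combinatorics using (_C_; nCk≡n!/k![n-k]!; k![n∸k]!∣n!; [n-k]*[n-k-1]!≡[n-k]!)
open import Data.Nat.DivMod using (m/n*n≡m)
open import Data.Nat.Tactic.RingSolver using (solve-∀)
open import Data.Integer as ℤ using (+_)
import Data.Integer.Properties as ℤ
open import Data.Rational as ℚ using (ℚ; 0ℚ; _/_)
import Data.Rational.Properties as ℚ
import Data.Rational.Unnormalised as ℚᵘ
import Data.Rational.Unnormalised.Properties as ℚᵘ
open import Data.Bool using (true; false)
open import Data.Fin.Subset using (Subset; inside; outside; ∣_∣; _⊆_; _∩_)
open import Data.Fin.Subset.Properties using (_⊆?_)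
open import Data.Vec using ([]; _∷_)
open import Data.Vec.Properties using (∷-injectiveʳ)
open import Data.List as List using (List; length; filter; _++_)
open import Data.List.Membership.Propositional using (_∈_; find; lose)
open import Data.List.Membership.Propositional.Properties
  using (∈-map⁺; ∈-map⁻; ∈-++⁺ˡ; ∈-++⁺ʳ; ∈-filter⁺; ∈-filter⁻)
open import Data.List.Relation.Unary.All using (All; [])
import Data.List.Relation.Unary.All as All
open import Data.List.Relation.Unary.All.Properties using (all-filter)
open import Data.List.Relation.Unary.Any using (Any; any?; here)
open import Data.List.Relation.Unary.AllPairs using ([]; _∷_)
open import Data.List.Relation.Unary.Unique.Propositional using (Unique)
import Data.List.Relation.Unary.Unique.Propositional.Properties as Unique
open import Data.Product using (_×_; _,_; proj₁; proj₂; ∃-syntax)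
open import Function using (_⇔_; mk⇔)
open import Relation.Binary.PropositionalEquality
open import Relation.Nullary using (Dec)
open import Relation.Nullary.Decidable using (_×-dec_)

private
  variable
    n k : ℕ

-- A finite set of k-element subsets of an n-element set, presented as a
-- duplicate-free list, so that its cardinality is the length of the list.
record Family (n k : ℕ) : Set where
  field
    members : List (Subset n)
    unique  : Unique members
    uniform : All (λ F → ∣ F ∣ ≡ k) members

open Family public

infix 4 _∈ᶠ_
_∈ᶠ_ : Subset n → Family n k → Set
F ∈ᶠ 𝓕 = F ∈ members 𝓕

card : Family n k → ℕ
card 𝓕 = length (members 𝓕)

Intersecting : ℕ → Family n k → Set
Intersecting t 𝓕 = ∀ F F′ → F ∈ᶠ 𝓕 → F′ ∈ᶠ 𝓕 → t ℕ.≤ ∣ F ∩ F′ ∣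

subsets : ∀ n → List (Subset n)
subsets zero    = [] List.∷ List.[]
subsets (suc n) = List.map (inside ∷_) (subsets n) ++ List.map (outside ∷_) (subsets n)

∈-subsets : (G : Subset n) → G ∈ subsets n
∈-subsets []          = here refl
∈-subsets (true  ∷ G) = ∈-++⁺ˡ (∈-map⁺ (inside ∷_) (∈-subsets G))
∈-subsets (false ∷ G) = ∈-++⁺ʳ _ (∈-map⁺ (outside ∷_) (∈-subsets G))

subsets-unique : ∀ n → Unique (subsets n)
subsets-unique zero    = [] ∷ []
subsets-unique (suc n) = Unique.++⁺
  (Unique.map⁺ ∷-injectiveʳ (subsets-unique n))
  (Unique.map⁺ ∷-injectiveʳ (subsets-unique n))
  disjoint
  where
  disjoint : ∀ {G} → G ∈ List.map (inside ∷_) (subsets n)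
                   × G ∈ List.map (outside ∷_) (subsets n) → _
  disjoint (p , q) with ∈-map⁻ (inside ∷_) p | ∈-map⁻ (outside ∷_) q
  ... | _ , _ , refl | _ , _ , ()

module _ (j : ℕ) (𝓕 : Family n k) where

  private
    size? : (G : Subset n) → Dec (∣ G ∣ ≡ k ∸ j)
    size? G = ∣ G ∣ ℕ.≟ k ∸ j

    below? : (G : Subset n) → Dec (Any (G ⊆_) (members 𝓕))
    below? G = any? (G ⊆?_) (members 𝓕)

    shadow? : (G : Subset n) → Dec (∣ G ∣ ≡ k ∸ j × Any (G ⊆_) (members 𝓕))
    shadow? G = size? G ×-dec below? G

  shadow : Family n (k ∸ j)
  shadow = record
    { members = filter shadow? (subsets n)
    ; unique  = Unique.filter⁺ shadow? (subsets-unique n)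
    ; uniform = All.map proj₁ (all-filter shadow? (subsets n))
    }

  ∈-shadow : ∀ G → G ∈ᶠ shadow ⇔ (∣ G ∣ ≡ k ∸ j × ∃[ F ] F ∈ᶠ 𝓕 × G ⊆ F)
  ∈-shadow G = mk⇔
    (λ p → let size , below = proj₂ (∈-filter⁻ shadow? {xs = subsets n} p)
           in size , find below)
    (λ (size , _ , F∈𝓕 , G⊆F) →
       ∈-filter⁺ shadow? (∈-subsets G) (size , lose F∈𝓕 G⊆F))

ℕ→ℚ : ℕ → ℚ
ℕ→ℚ m = + m / 1

-- Rational tolerances suffice for convergence to 0, and every null real
-- sequence lies below a null rational one.  Hence an error term that only
-- weakens a bound as it grows may be taken with values in ℚ.
_⟶0 : (ℕ → ℚ) → Set
ε ⟶0 = ∀ δ → 0ℚ ℚ.< δ → ∃[ N ] ∀ n → N ℕ.≤ n → ℚ.∣ ε n ∣ ℚ.< δ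

C*k![n∸k]!≡n! : k ℕ.≤ n → (n C k) ℕ.* (k ! ℕ.* (n ∸ k) !) ≡ n !
C*k![n∸k]!≡n! {k} {n} k≤n =
  trans (cong (ℕ._* d) (nCk≡n!/k![n-k]! k≤n)) (m/n*n≡m (k![n∸k]!∣n! k≤n))
  where
  d = k ! ℕ.* (n ∸ k) !
  instance _ = k ℕ.!* (n ∸ k) !≢0

C-nonZero : k ℕ.≤ n → NonZero (n C k)
C-nonZero {k} {n} k≤n = ℕ.≢-nonZero λ nCk≡0 → ℕ.≢-nonZero⁻¹ (n !) {{n ℕ.!≢0}}
  (trans (sym (C*k![n∸k]!≡n! k≤n)) (cong (ℕ._* (k ! ℕ.* (n ∸ k) !)) nCk≡0))

t+ℓ≤t+2ℓ : ∀ ℓ t → t ℕ.+ ℓ ℕ.≤ t ℕ.+ 2 ℕ.* ℓ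
t+ℓ≤t+2ℓ ℓ t = ℕ.+-monoʳ-≤ t (ℕ.m≤m+n ℓ _)

γ : (ℓ t j : ℕ) → ℚ
γ ℓ t j = + ((t ℕ.+ 2 ℕ.* ℓ) C (t ℕ.+ ℓ ∸ j)) / ((t ℕ.+ 2 ℕ.* ℓ) C (t ℕ.+ ℓ))
  where instance _ = C-nonZero (t+ℓ≤t+2ℓ ℓ t)

C-absorb : k ℕ.≤ n → (suc n ∸ k) ℕ.* (suc n C k) ≡ suc n ℕ.* (n C k)
C-absorb {k} {n} k≤n = ℕ.*-cancelʳ-≡ _ _ d (begin
  (s ℕ.* c′) ℕ.* (k ! ℕ.* (n ∸ k) !)       ≡⟨ lemma s c′ (k !) ((n ∸ k) !) ⟩
  c′ ℕ.* (k ! ℕ.* (s ℕ.* (n ∸ k) !))       ≡⟨ cong (λ x → c′ ℕ.* (k ! ℕ.* x)) ([n-k]*[n-k-1]!≡[n-k]! (s≤s k≤n)) ⟩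
  c′ ℕ.* (k ! ℕ.* s !)                     ≡⟨ C*k![n∸k]!≡n! (ℕ.m≤n⇒m≤1+n k≤n) ⟩
  suc n ℕ.* n !                            ≡⟨ cong (suc n ℕ.*_) (C*k![n∸k]!≡n! k≤n) ⟨
  suc n ℕ.* ((n C k) ℕ.* d)                ≡⟨ ℕ.*-assoc (suc n) (n C k) d ⟨
  suc n ℕ.* (n C k) ℕ.* d                  ∎)
  where
  open ≡-Reasoning
  s  = suc n ∸ k
  c′ = suc n C k
  d  = k ! ℕ.* (n ∸ k) !
  instance _ = k ℕ.!* (n ∸ k) !≢0
  lemma : ∀ a b c d → (a ℕ.* b) ℕ.* (c ℕ.* d) ≡ b ℕ.* (c ℕ.* (a ℕ.* d))
  lemma = solve-∀

C-cross : ∀ {m a b} → a ℕ.< b → b ℕ.≤ m →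
          (suc m C a) ℕ.* (m C b) ℕ.< (m C a) ℕ.* (suc m C b)
C-cross {m} {a} {b} a<b b≤m = ℕ.*-cancelˡ-< (suc m) _ _ (begin-strict
  suc m ℕ.* (A ℕ.* (m C b))        ≡⟨ lemma₁ (suc m) A (m C b) ⟩
  (suc m ℕ.* (m C b)) ℕ.* A        ≡⟨ cong (ℕ._* A) (C-absorb b≤m) ⟨
  ((suc m ∸ b) ℕ.* B) ℕ.* A        ≡⟨ ℕ.*-assoc (suc m ∸ b) B A ⟩
  (suc m ∸ b) ℕ.* (B ℕ.* A)        <⟨ ℕ.*-monoˡ-< (B ℕ.* A) (ℕ.∸-monoʳ-< a<b (ℕ.m≤n⇒m≤1+n b≤m)) ⟩
  (suc m ∸ a) ℕ.* (B ℕ.* A)        ≡⟨ lemma₂ (suc m ∸ a) B A ⟩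
  ((suc m ∸ a) ℕ.* A) ℕ.* B        ≡⟨ cong (ℕ._* B) (C-absorb a≤m) ⟩
  suc m ℕ.* (m C a) ℕ.* B          ≡⟨ ℕ.*-assoc (suc m) (m C a) B ⟩
  suc m ℕ.* ((m C a) ℕ.* B)        ∎)
  where
  open ℕ.≤-Reasoning
  a≤m = ℕ.≤-trans (ℕ.<⇒≤ a<b) b≤m
  A = suc m C a
  B = suc m C b
  instance
    A≢0  = C-nonZero {a} {suc m} (ℕ.m≤n⇒m≤1+n a≤m)
    B≢0  = C-nonZero {b} {suc m} (ℕ.m≤n⇒m≤1+n b≤m)
    BA≢0 = ℕ.m*n≢0 B A {{B≢0}} {{A≢0}}
  lemma₁ : ∀ x y z → x ℕ.* (y ℕ.* z) ≡ (x ℕ.* z) ℕ.* y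
  lemma₁ = solve-∀
  lemma₂ : ∀ x y z → x ℕ.* (y ℕ.* z) ≡ (x ℕ.* z) ℕ.* y
  lemma₂ = solve-∀

/-cross-< : ∀ p q r s .{{_ : NonZero q}} .{{_ : NonZero s}} →
            p ℕ.* s ℕ.< r ℕ.* q → + p / q ℚ.< + r / s
/-cross-< p (suc q) r (suc s) ps<rq = ℚ.toℚᵘ-cancel-<
  (ℚᵘ.<-respʳ-≃ (ℚᵘ.≃-sym (ℚ.toℚᵘ-fromℚᵘ (+ r ℚᵘ./ suc s)))
  (ℚᵘ.<-respˡ-≃ (ℚᵘ.≃-sym (ℚ.toℚᵘ-fromℚᵘ (+ p ℚᵘ./ suc q)))
  (ℚᵘ.*<* (subst₂ ℤ._<_ (ℤ.pos-* p (suc s)) (ℤ.pos-* r (suc q)) (ℤ.+<+ ps<rq)))))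

γ-step : ∀ w t j → 1 ℕ.≤ w → 1 ℕ.≤ j → j ℕ.< t → γ w t j ℚ.< γ (w ∸ 1) (suc t) j
γ-step (suc w) t j _ 1≤j j<t =
  /-cross-< (M C (t ℕ.+ suc w ∸ j)) (M C (t ℕ.+ suc w)) (m C (b ∸ j)) (m C b)
    {{C-nonZero (t+ℓ≤t+2ℓ (suc w) t)}} {{C-nonZero b≤m}} cross
  where
  M = t ℕ.+ 2 ℕ.* suc w
  m = suc t ℕ.+ 2 ℕ.* w
  b = suc t ℕ.+ w
  b≤m = t+ℓ≤t+2ℓ w (suc t)
  M≡ : M ≡ suc m
  M≡ = eq t w
    where
    eq : ∀ t w → t ℕ.+ 2 ℕ.* suc w ≡ suc (suc t ℕ.+ 2 ℕ.* w)
    eq = solve-∀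
  cross : (M C (t ℕ.+ suc w ∸ j)) ℕ.* (m C b)
          ℕ.< (m C (b ∸ j)) ℕ.* (M C (t ℕ.+ suc w))
  cross rewrite M≡ | ℕ.+-suc t w = C-cross (ℕ.∸-monoʳ-< 1≤j j≤b) b≤m
    where
    j≤b : j ℕ.≤ b
    j≤b = ℕ.≤-trans (ℕ.<⇒≤ j<t) (ℕ.≤-trans (ℕ.n≤1+n t) (ℕ.m≤m+n (suc t) w))

-- In the application this difference is the denominator β; see γ-step for
-- its positivity.
β-nonZero : ∀ {w t j} → 1 ℕ.≤ w → 1 ℕ.≤ j → j ℕ.< t →
            ℚ.NonZero (γ (w ∸ 1) (suc t) j ℚ.- γ w t j)
β-nonZero {w} {t} {j} 1≤w 1≤j j<t = ℚ.>-nonZero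
  (subst (ℚ._< x ℚ.- y) (ℚ.+-inverseʳ y) (ℚ.+-monoˡ-< (ℚ.- y) (γ-step w t j 1≤w 1≤j j<t)))
  where
  x = γ (w ∸ 1) (suc t) j
  y = γ w t j

-- Shifting makes the family stable, without changing its size or its
-- intersections and without enlarging the shadow.  In a stable t-intersecting
-- family any two members F, F′ have a prefix [m] with
-- |F ∩ [m]| + |F′ ∩ [m]| ≥ m + t; otherwise their common elements could be
-- shifted apart.  With F = F′ this gives a window [t + 2ℓ], ℓ ≤ k − t, in which
-- F has at least t + ℓ elements.  If all members have such a window with ℓ ≤ w,
-- local LYM inequalities in the windows give the ratio γ(w, t, j).  Otherwise
-- the prefix property, applied to F and a member without such a window, shows
-- that every F with at most t + w elements in [2k − t] has a window
-- [t + 1 + 2ℓ], ℓ < w, containing at least t + 1 + ℓ elements, and these F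
-- contribute with the larger ratio γ(w − 1, t + 1, j).  The remaining members
-- contribute with ratio γ(k − t, t, j), and as the t'th shadow inside [2k − t]
-- does not shrink their number, there are at most
-- (1 + O(1/n)) C(2k − t, w + 1) C(n − 2k + t, k − w − t − 1) of them.

{-# OPTIONS --safe #-}
module Submission where

open import Defs
open import Data.Nat using (ℕ; suc; _≤_; _<_; _∸_)
import Data.Nat as ℕ
import Data.Nat.Properties as ℕ
open import Data.Nat.Combinatorics using (_C_)
open import Data.Product using (_×_; ∃-syntax)
import Data.Rational as ℚ
open import Relation.Binary.PropositionalEquality

-- The constant in the hypothesis comes from comparing three ratios. Put A = γ(w - 1, t + 1, j), G =
-- γ(w, t, j) and B = γ(k - t, t, j), so that β = A - G and α + β = A - B. If h members are
-- exceptional, the shadow has at least A (|F| - h) + B h elements, and this is at least G |F|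
-- exactly when (A - B) h ≤ (A - G) |F|. The hypothesis is thus the bound on h times (A - B) / (A -
-- G), and ε absorbs the error in that bound.
--
-- Adding the two contributions requires disjoint shadows. For this reason elements are deleted only
-- inside windows contained in [2k - t]: a resulting set then has exactly j fewer elements in
-- [2k - t] than its source, so sources on different sides of a threshold never share one.
--
-- The bound on h is taken in the t'th shadow because of its leading term. Deleting t elements of
-- [2k - t] leaves at least w + 1 of them, which gives C(2k - t, w + 1); counting the members
-- themselves would give C(2k - t, t + w + 1), which is no smaller.

module _ where

  open import Data.Bool using (Bool; true; false; _∧_; _∨_; not)
  open import Data.Bool.Properties using () renaming (_≟_ to _≟ᵇ_)
  open import Data.Empty using (⊥; ⊥-elim)
  open import Data.Fin.Subset using (Subset; ∣_∣; _∩_; _⊆_)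
  open import Data.Fin.Subset.Properties using (anySubset?; out⊆; s⊆s; ⊆-refl)
  import Data.Integer as ℤ
  import Data.Integer.Properties as ℤ
  open import Data.List using (List; []; _∷_; length)
  import Data.List.Membership.DecPropositional as DecMembership
  open import Data.List.Membership.Propositional using (_∈_)
  import Data.List.Relation.Unary.All as All
  open import Data.List.Relation.Unary.All.Properties using (All¬⇒¬Any)
  open import Data.List.Relation.Unary.AllPairs using ([]; _∷_)
  open import Data.List.Relation.Unary.Any using (here; there)
  open import Data.List.Relation.Unary.Unique.Propositional using (Unique)
  open import Data.Nat
    using (zero; _+_; _*_; _≤?_; _<?_; _⊔_; z≤n; s≤s; NonZero; >-nonZero; >-nonZero⁻¹; ≢-nonZero⁻¹)
  open import Data.Nat.Combinatorics using (nC1≡n; nCk≡nC[n∸k]; k>n⇒nCk≡0; nCk+nC[k+1]≡[n+1]C[k+1])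
  open import Data.Nat.Induction using (<-wellFounded)
  open import Data.Nat.Properties
  open import Data.Nat.Tactic.RingSolver using (solve-∀)
  open import Data.Product using (_,_; proj₁; proj₂; Σ-syntax)
  open import Data.Rational using (ℚ; 0ℚ; _/_)
  import Data.Rational.Properties as ℚ
  import Data.Rational.Solver as ℚSolver
  import Data.Rational.Unnormalised as ℚᵘ
  import Data.Rational.Unnormalised.Properties as ℚᵘ
  open import Data.Sum as Sum using (_⊎_; inj₁; inj₂)
  open import Data.Unit using (⊤; tt)
  open import Data.Vec using ([]; _∷_)
  open import Data.Vec.Properties using (≡-dec)
  open import Function using (Equivalence)
  open import Induction.WellFounded using (Acc; acc)
  open import Relation.Binary.Definitions using (DecidableEquality)
  open import Relation.Nullary using (¬_; yes; no; Dec; does)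
  open import Relation.Nullary.Decidable using (_×-dec_; ¬?; decidable-stable)

  private
    variable
      n k : ℕ

  -- Conjunction and disjunction are abstract so that they stay rigid and their
  -- arguments can be inferred by unification.
  abstract
    infixr 6 _and_
    infixr 5 _or_
    _and_ _or_ : Bool → Bool → Bool
    _and_ = _∧_
    _or_  = _∨_

    ∧-true : ∀ {a b} → a and b ≡ true → a ≡ true × b ≡ true
    ∧-true {true} {true} _ = refl , refl

    ∧-intro : ∀ {a b} → a ≡ true → b ≡ true → a and b ≡ true
    ∧-intro refl refl = refl

    ∨-true : ∀ {a b} → a or b ≡ true → a ≡ true ⊎ b ≡ true
    ∨-true {true}  _ = inj₁ refl
    ∨-true {false} p = inj₂ p

    ∨-introˡ : ∀ {a b} → a ≡ true → a or b ≡ true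
    ∨-introˡ refl = refl

    ∨-introʳ : ∀ {a b} → b ≡ true → a or b ≡ true
    ∨-introʳ {true}  _ = refl
    ∨-introʳ {false} p = p

  does-true : ∀ {A : Set} (d : Dec A) → A → does d ≡ true
  does-true (yes _) _ = refl
  does-true (no ¬a) a = ⊥-elim (¬a a)

  true-does : ∀ {A : Set} (d : Dec A) → does d ≡ true → A
  true-does (yes a) _ = a

  not-does : ∀ {A : Set} (d : Dec A) → not (does d) ≡ true → ¬ A
  not-does (no ¬a) _ = ¬a

  ⟦_⟧ : Bool → ℕ
  ⟦ true ⟧  = 1
  ⟦ false ⟧ = 0

  ⟦⟧-mono : ∀ {a b} → (a ≡ true → b ≡ true) → ⟦ a ⟧ ≤ ⟦ b ⟧
  ⟦⟧-mono {true}  {b} h rewrite h refl = ≤-refl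
  ⟦⟧-mono {false}     h = z≤n

  abstract
    ⟦⟧-modular : ∀ a b → ⟦ a or b ⟧ + ⟦ a and b ⟧ ≡ ⟦ a ⟧ + ⟦ b ⟧
    ⟦⟧-modular true  b = refl
    ⟦⟧-modular false b = +-identityʳ ⟦ b ⟧

    ⟦⟧-split : ∀ a b → ⟦ a ⟧ ≡ ⟦ a and b ⟧ + ⟦ a and not b ⟧
    ⟦⟧-split false b     = refl
    ⟦⟧-split true  true  = refl
    ⟦⟧-split true  false = refl

    -- Here `a` and `b` stand for membership of two sets that begin with 10 and 01 and agree
    -- afterwards. The shift lowers the weight, by one, exactly when only the second is a member;
    -- the summand `⟦ b and not a ⟧` records this.
    swap-weight : ∀ a b x → ⟦ a or b ⟧ * x + ⟦ a and b ⟧ * suc x + ⟦ b and not a ⟧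
                          ≡ ⟦ a ⟧ * x + ⟦ b ⟧ * suc x
    swap-weight true  true  x = +-identityʳ _
    swap-weight true  false x = +-identityʳ _
    swap-weight false true  x = eq x
      where
      eq : ∀ x → x + 0 + 0 + 1 ≡ suc x + 0
      eq = solve-∀
    swap-weight false false x = refl

    ⟦and-not⟧≡0 : ∀ {a b} → ⟦ b and not a ⟧ ≡ 0 → b ≡ true → a ≡ true
    ⟦and-not⟧≡0 {true} _ _ = refl
    ⟦and-not⟧≡0 {false} {true} () _

  -- Sums over the subsets of an n-element set

  BoolFam : ℕ → Set
  BoolFam n = Subset n → Bool

  infix 4 _∋_ _⊑_
  _∋_ : BoolFam n → Subset n → Set
  f ∋ F = f F ≡ true

  _⊑_ : BoolFam n → BoolFam n → Set
  f ⊑ g = ∀ F → f ∋ F → g ∋ F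

  -- The recursion splits by the first coordinate, as shifts, shadows and prefixes do, so identities
  -- between counts can be proved section by section.
  ∑ : (Subset n → ℕ) → ℕ
  ∑ {zero}  h = h []
  ∑ {suc n} h = ∑ (λ F → h (true ∷ F)) + ∑ (λ F → h (false ∷ F))

  cnt : BoolFam n → ℕ
  cnt f = ∑ (λ F → ⟦ f F ⟧)

  ∑-mono : {h g : Subset n → ℕ} → (∀ F → h F ≤ g F) → ∑ h ≤ ∑ g
  ∑-mono {zero}  le = le []
  ∑-mono {suc n} le = +-mono-≤ (∑-mono (λ F → le (true ∷ F))) (∑-mono (λ F → le (false ∷ F)))

  ∑-cong : {h g : Subset n → ℕ} → (∀ F → h F ≡ g F) → ∑ h ≡ ∑ g
  ∑-cong eq = ≤-antisym (∑-mono (λ F → ≤-reflexive (eq F))) (∑-mono (λ F → ≤-reflexive (sym (eq F))))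

  +-interchange : ∀ a b c d → (a + b) + (c + d) ≡ (a + c) + (b + d)
  +-interchange = solve-∀

  ∑-+ : (h g : Subset n → ℕ) → ∑ (λ F → h F + g F) ≡ ∑ h + ∑ g
  ∑-+ {zero}  h g = refl
  ∑-+ {suc n} h g = trans
    (cong₂ _+_ (∑-+ (λ F → h (true ∷ F)) (λ F → g (true ∷ F)))
               (∑-+ (λ F → h (false ∷ F)) (λ F → g (false ∷ F))))
    (+-interchange (∑ (λ F → h (true ∷ F))) _ _ _)

  ∑-*ʳ : (h : Subset n → ℕ) (c : ℕ) → ∑ (λ F → h F * c) ≡ ∑ h * c
  ∑-*ʳ {zero}  h c = refl
  ∑-*ʳ {suc n} h c = trans
    (cong₂ _+_ (∑-*ʳ (λ F → h (true ∷ F)) c) (∑-*ʳ (λ F → h (false ∷ F)) c))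
    (sym (*-distribʳ-+ c (∑ (λ F → h (true ∷ F))) _))

  ∑-0 : ∑ {n} (λ _ → 0) ≡ 0
  ∑-0 {zero}  = refl
  ∑-0 {suc n} = cong₂ _+_ (∑-0 {n}) (∑-0 {n})

  ∑≡0 : {h : Subset n → ℕ} → ∑ h ≡ 0 → ∀ F → h F ≡ 0
  ∑≡0 {zero}      eq []          = eq
  ∑≡0 {suc n} {h} eq (true ∷ F)  = ∑≡0 (m+n≡0⇒m≡0 _ eq) F
  ∑≡0 {suc n} {h} eq (false ∷ F) = ∑≡0 (m+n≡0⇒n≡0 (∑ (λ F → h (true ∷ F))) eq) F

  cnt-mono : {f g : BoolFam n} → f ⊑ g → cnt f ≤ cnt g
  cnt-mono f⊑g = ∑-mono (λ F → ⟦⟧-mono (f⊑g F))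

  cnt-disjoint : {f g h : BoolFam n} → f ⊑ h → g ⊑ h →
                 (∀ F → f ∋ F → g ∋ F → ⊥) → cnt f + cnt g ≤ cnt h
  cnt-disjoint {f = f} {g} {h} f⊑h g⊑h disj = ≤-trans
    (≤-reflexive (sym (∑-+ (λ F → ⟦ f F ⟧) (λ F → ⟦ g F ⟧))))
    (∑-mono (λ F → pointwise (f F) (g F) (h F) (f⊑h F) (g⊑h F) (disj F)))
    where
    pointwise : ∀ a b c → (a ≡ true → c ≡ true) → (b ≡ true → c ≡ true) →
                (a ≡ true → b ≡ true → ⊥) → ⟦ a ⟧ + ⟦ b ⟧ ≤ ⟦ c ⟧
    pointwise true  true  c p q r = ⊥-elim (r refl refl)
    pointwise true  false c p q r = ⟦⟧-mono p
    pointwise false b     c p q r = ⟦⟧-mono q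

  cnt-split : (f p : BoolFam n) →
              cnt f ≡ cnt (λ F → f F and p F) + cnt (λ F → f F and not (p F))
  cnt-split f p = trans (∑-cong (λ F → ⟦⟧-split (f F) (p F)))
                        (∑-+ (λ F → ⟦ f F and p F ⟧) (λ F → ⟦ f F and not (p F) ⟧))

  -- Adjacent shifts

  -- Stability under the shifts of neighbouring positions already gives
  -- stability under all shifts.
  shift : ℕ → BoolFam n → BoolFam n
  shift i       f []                 = f []
  shift zero    f (a ∷ [])           = f (a ∷ [])
  shift zero    f (true ∷ true ∷ F)  = f (true ∷ true ∷ F)
  shift zero    f (true ∷ false ∷ F) = f (true ∷ false ∷ F) or f (false ∷ true ∷ F)
  shift zero    f (false ∷ true ∷ F) = f (true ∷ false ∷ F) and f (false ∷ true ∷ F)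
  shift zero    f (false ∷ false ∷ F) = f (false ∷ false ∷ F)
  shift (suc i) f (a ∷ F)            = shift i (λ F → f (a ∷ F)) F

  cnt-shift : ∀ i (f : BoolFam n) → cnt (shift i f) ≡ cnt f
  cnt-shift {zero}        i       f = refl
  cnt-shift {suc zero}    zero    f = refl
  cnt-shift {suc (suc n)} zero    f = begin
    (x₁ + cnt u) + (cnt v + x₄)   ≡⟨ middle x₁ (cnt u) (cnt v) x₄ ⟩
    (x₁ + x₄) + (cnt u + cnt v)   ≡⟨ cong ((x₁ + x₄) +_) modular ⟩
    (x₁ + x₄) + (cnt f₁₀ + cnt f₀₁) ≡⟨ middle x₁ (cnt f₁₀) (cnt f₀₁) x₄ ⟨
    (x₁ + cnt f₁₀) + (cnt f₀₁ + x₄) ∎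
    where
    open ≡-Reasoning
    f₁₀ f₀₁ u v : BoolFam n
    f₁₀ F = f (true ∷ false ∷ F)
    f₀₁ F = f (false ∷ true ∷ F)
    u F = f₁₀ F or f₀₁ F
    v F = f₁₀ F and f₀₁ F
    x₁ = cnt (λ (F : Subset n) → f (true ∷ true ∷ F))
    x₄ = cnt (λ (F : Subset n) → f (false ∷ false ∷ F))
    middle : ∀ a b c d → (a + b) + (c + d) ≡ (a + d) + (b + c)
    middle = solve-∀
    modular : cnt u + cnt v ≡ cnt f₁₀ + cnt f₀₁
    modular = trans (sym (∑-+ (λ F → ⟦ u F ⟧) (λ F → ⟦ v F ⟧)))
      (trans (∑-cong (λ F → ⟦⟧-modular (f₁₀ F) (f₀₁ F)))
             (∑-+ (λ F → ⟦ f₁₀ F ⟧) (λ F → ⟦ f₀₁ F ⟧)))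
  cnt-shift {suc n} (suc i) f =
    cong₂ _+_ (cnt-shift i (λ F → f (true ∷ F))) (cnt-shift i (λ F → f (false ∷ F)))

  shift-∋ : ∀ i (f : BoolFam n) F → shift i f ∋ F → ∃[ F′ ] f ∋ F′ × ∣ F ∣ ≡ ∣ F′ ∣
  shift-∋ i       f []                    p = _ , p , refl
  shift-∋ zero    f (a ∷ [])              p = _ , p , refl
  shift-∋ zero    f (true ∷ true ∷ F)     p = _ , p , refl
  shift-∋ zero    f (true ∷ false ∷ F)    p with ∨-true p
  ... | inj₁ q = _ , q , refl
  ... | inj₂ q = _ , q , refl
  shift-∋ zero    f (false ∷ true ∷ F)    p = _ , proj₂ (∧-true p) , refl
  shift-∋ zero    f (false ∷ false ∷ F)   p = _ , p , refl
  shift-∋ (suc i) f (true ∷ F)            p =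
    let F′ , q , eq = shift-∋ i (λ F → f (true ∷ F)) F p in true ∷ F′ , q , cong suc eq
  shift-∋ (suc i) f (false ∷ F)           p =
    let F′ , q , eq = shift-∋ i (λ F → f (false ∷ F)) F p in false ∷ F′ , q , eq

  Uniform : ℕ → BoolFam n → Set
  Uniform k f = ∀ F → f ∋ F → ∣ F ∣ ≡ k

  shift-uniform : ∀ i {f : BoolFam n} → Uniform k f → Uniform k (shift i f)
  shift-uniform i {f} u F p = let F′ , q , eq = shift-∋ i f F p in trans eq (u F′ q)

  -- The offset counts common elements already passed by the recursion.
  CrossInt : (t e : ℕ) → BoolFam n → BoolFam n → Set
  CrossInt t e f g = ∀ F G → f ∋ F → g ∋ G → t ≤ e + ∣ F ∩ G ∣

  bump : ∀ {t} e x → t ≤ suc e + x → t ≤ e + suc x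
  bump {t} e x = subst (t ≤_) (sym (+-suc e x))

  unbump : ∀ {t} e x → t ≤ e + suc x → t ≤ suc e + x
  unbump {t} e x = subst (t ≤_) (+-suc e x)

  weaken : ∀ {t} e x → t ≤ e + x → t ≤ e + suc x
  weaken e x p = ≤-trans p (+-monoʳ-≤ e (n≤1+n x))

  -- Two families occur because F and G may begin differently and then lie in different sections.
  -- The critical pair is a new set 10F and a surviving set 01G: survival means that 10G is a member
  -- as well, and the hypothesis is applied to 01F and 10G, which again have no common element in
  -- the two columns.
  shift-crossInt : ∀ i {t} e (f g : BoolFam n) → CrossInt t e f g → CrossInt t e (shift i f) (shift i g)
  shift-crossInt i    e f g c []       []       p q = c [] [] p q
  shift-crossInt zero e f g c (a ∷ []) (b ∷ []) p q = c (a ∷ []) (b ∷ []) p q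
  shift-crossInt zero e f g c (true ∷ true ∷ F) (true ∷ true ∷ G) p q = c _ _ p q
  shift-crossInt zero e f g c (true ∷ true ∷ F) (false ∷ false ∷ G) p q = c _ _ p q
  shift-crossInt zero e f g c (true ∷ true ∷ F) (true ∷ false ∷ G) p q with ∨-true q
  ... | inj₁ q′ = c _ _ p q′
  ... | inj₂ q′ = c (true ∷ true ∷ F) (false ∷ true ∷ G) p q′
  shift-crossInt zero e f g c (true ∷ true ∷ F) (false ∷ true ∷ G) p q =
    c (true ∷ true ∷ F) (false ∷ true ∷ G) p (proj₂ (∧-true q))
  shift-crossInt zero e f g c (false ∷ false ∷ F) (true ∷ true ∷ G) p q = c _ _ p q
  shift-crossInt zero e f g c (false ∷ false ∷ F) (false ∷ false ∷ G) p q = c _ _ p q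
  shift-crossInt zero e f g c (false ∷ false ∷ F) (true ∷ false ∷ G) p q with ∨-true q
  ... | inj₁ q′ = c _ _ p q′
  ... | inj₂ q′ = c (false ∷ false ∷ F) (false ∷ true ∷ G) p q′
  shift-crossInt zero e f g c (false ∷ false ∷ F) (false ∷ true ∷ G) p q =
    c (false ∷ false ∷ F) (false ∷ true ∷ G) p (proj₂ (∧-true q))
  shift-crossInt zero e f g c (true ∷ false ∷ F) (true ∷ true ∷ G) p q with ∨-true p
  ... | inj₁ p′ = c _ _ p′ q
  ... | inj₂ p′ = c (false ∷ true ∷ F) (true ∷ true ∷ G) p′ q
  shift-crossInt zero e f g c (true ∷ false ∷ F) (false ∷ false ∷ G) p q with ∨-true p
  ... | inj₁ p′ = c _ _ p′ q
  ... | inj₂ p′ = c (false ∷ true ∷ F) (false ∷ false ∷ G) p′ q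
  shift-crossInt zero e f g c (true ∷ false ∷ F) (true ∷ false ∷ G) p q with ∨-true p | ∨-true q
  ... | inj₁ p′ | inj₁ q′ = c _ _ p′ q′
  ... | inj₁ p′ | inj₂ q′ = weaken e ∣ F ∩ G ∣ (c (true ∷ false ∷ F) (false ∷ true ∷ G) p′ q′)
  ... | inj₂ p′ | inj₁ q′ = weaken e ∣ F ∩ G ∣ (c (false ∷ true ∷ F) (true ∷ false ∷ G) p′ q′)
  ... | inj₂ p′ | inj₂ q′ = c (false ∷ true ∷ F) (false ∷ true ∷ G) p′ q′
  shift-crossInt zero e f g c (true ∷ false ∷ F) (false ∷ true ∷ G) p q with ∨-true p
  ... | inj₁ p′ = c (true ∷ false ∷ F) (false ∷ true ∷ G) p′ (proj₂ (∧-true q))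
  ... | inj₂ p′ = c (false ∷ true ∷ F) (true ∷ false ∷ G) p′ (proj₁ (∧-true q))
  shift-crossInt zero e f g c (false ∷ true ∷ F) (true ∷ true ∷ G) p q =
    c (false ∷ true ∷ F) (true ∷ true ∷ G) (proj₂ (∧-true p)) q
  shift-crossInt zero e f g c (false ∷ true ∷ F) (false ∷ false ∷ G) p q =
    c (false ∷ true ∷ F) (false ∷ false ∷ G) (proj₂ (∧-true p)) q
  shift-crossInt zero e f g c (false ∷ true ∷ F) (true ∷ false ∷ G) p q with ∨-true q
  ... | inj₁ q′ = c (false ∷ true ∷ F) (true ∷ false ∷ G) (proj₂ (∧-true p)) q′
  ... | inj₂ q′ = c (true ∷ false ∷ F) (false ∷ true ∷ G) (proj₁ (∧-true p)) q′
  shift-crossInt zero e f g c (false ∷ true ∷ F) (false ∷ true ∷ G) p q =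
    c (false ∷ true ∷ F) (false ∷ true ∷ G) (proj₂ (∧-true p)) (proj₂ (∧-true q))
  shift-crossInt (suc i) e f g c (true ∷ F) (true ∷ G) p q = bump e ∣ F ∩ G ∣
    (shift-crossInt i (suc e) _ _ (λ F G p q → unbump e ∣ F ∩ G ∣ (c (true ∷ F) (true ∷ G) p q)) F G p q)
  shift-crossInt (suc i) e f g c (true ∷ F) (false ∷ G) p q =
    shift-crossInt i e _ _ (λ F G → c (true ∷ F) (false ∷ G)) F G p q
  shift-crossInt (suc i) e f g c (false ∷ F) (true ∷ G) p q =
    shift-crossInt i e _ _ (λ F G → c (false ∷ F) (true ∷ G)) F G p q
  shift-crossInt (suc i) e f g c (false ∷ F) (false ∷ G) p q =
    shift-crossInt i e _ _ (λ F G → c (false ∷ F) (false ∷ G)) F G p q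

  shift-mono : ∀ i {f g : BoolFam n} → f ⊑ g → shift i f ⊑ shift i g
  shift-mono i       le []                    p = le _ p
  shift-mono zero    le (a ∷ [])              p = le _ p
  shift-mono zero    le (true ∷ true ∷ F)     p = le _ p
  shift-mono zero    le (true ∷ false ∷ F)    p with ∨-true p
  ... | inj₁ q = ∨-introˡ (le _ q)
  ... | inj₂ q = ∨-introʳ (le _ q)
  shift-mono zero    le (false ∷ true ∷ F)    p =
    ∧-intro (le _ (proj₁ (∧-true p))) (le _ (proj₂ (∧-true p)))
  shift-mono zero    le (false ∷ false ∷ F)   p = le _ p
  shift-mono (suc i) le (a ∷ F)               p = shift-mono i (λ F → le (a ∷ F)) F p

  -- Shadows

  -- The whole down-set, with all sizes at once; the j'th shadow is one level of it. Sizes need not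
  -- be tracked while shadows are compared with shifts.
  below : BoolFam n → BoolFam n
  below f []          = f []
  below f (true ∷ G)  = below (λ F → f (true ∷ F)) G
  below f (false ∷ G) = below (λ F → f (true ∷ F)) G or below (λ F → f (false ∷ F)) G

  below-mono : {f g : BoolFam n} → f ⊑ g → below f ⊑ below g
  below-mono le []          p = le [] p
  below-mono le (true ∷ G)  p = below-mono (λ F → le (true ∷ F)) G p
  below-mono le (false ∷ G) p with ∨-true p
  ... | inj₁ q = ∨-introˡ (below-mono (λ F → le (true ∷ F)) G q)
  ... | inj₂ q = ∨-introʳ (below-mono (λ F → le (false ∷ F)) G q)

  below-∨ : (f g : BoolFam n) → ∀ G → below (λ F → f F or g F) ∋ G → below f G or below g G ≡ true
  below-∨ f g []          p = p
  below-∨ f g (true ∷ G)  p = below-∨ (λ F → f (true ∷ F)) (λ F → g (true ∷ F)) G p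
  below-∨ f g (false ∷ G) p with ∨-true p
  ... | inj₁ q with ∨-true (below-∨ (λ F → f (true ∷ F)) (λ F → g (true ∷ F)) G q)
  ...   | inj₁ r = ∨-introˡ (∨-introˡ r)
  ...   | inj₂ r = ∨-introʳ (∨-introˡ r)
  below-∨ f g (false ∷ G) p | inj₂ q with ∨-true (below-∨ (λ F → f (false ∷ F)) (λ F → g (false ∷ F)) G q)
  ...   | inj₁ r = ∨-introˡ (∨-introʳ r)
  ...   | inj₂ r = ∨-introʳ (∨-introʳ r)

  below-extensive : (f : BoolFam n) → f ⊑ below f
  below-extensive f []          p = p
  below-extensive f (true ∷ G)  p = below-extensive (λ F → f (true ∷ F)) G p
  below-extensive f (false ∷ G) p = ∨-introʳ (below-extensive (λ F → f (false ∷ F)) G p)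

  below-idem : (f : BoolFam n) → below (below f) ⊑ below f
  below-idem f []          p = p
  below-idem f (true ∷ G)  p = below-idem (λ F → f (true ∷ F)) G p
  below-idem f (false ∷ G) p with ∨-true p
  ... | inj₁ q = ∨-introˡ (below-idem (λ F → f (true ∷ F)) G q)
  ... | inj₂ q with ∨-true (below-∨ (below (λ F → f (true ∷ F))) (below (λ F → f (false ∷ F))) G q)
  ...   | inj₁ r = ∨-introˡ (below-idem (λ F → f (true ∷ F)) G r)
  ...   | inj₂ r = ∨-introʳ (below-idem (λ F → f (false ∷ F)) G r)

  -- A shift preserves cardinality, so this containment is why shifting does not enlarge the shadow.
  -- A new member 10F of the shifted family comes from 01F: the subsets 10G of the former correspond
  -- to subsets 01G of the latter, and the subsets 00G are common to both.
  below-shift : ∀ i (f : BoolFam n) → below (shift i f) ⊑ shift i (below f)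
  below-shift i       f []              p = p
  below-shift zero    f (true ∷ [])     p = p
  below-shift zero    f (false ∷ [])    p = p
  below-shift zero    f (true ∷ true ∷ G) p = p
  below-shift zero    f (true ∷ false ∷ G) p with ∨-true p
  ... | inj₁ q = ∨-introˡ (∨-introˡ q)
  ... | inj₂ q with ∨-true (below-∨ (λ F → f (true ∷ false ∷ F)) (λ F → f (false ∷ true ∷ F)) G q)
  ...   | inj₁ r = ∨-introˡ (∨-introʳ r)
  ...   | inj₂ r = ∨-introʳ (∨-introʳ r)
  below-shift zero    f (false ∷ true ∷ G) p with ∨-true p
  ... | inj₁ q = ∧-intro (∨-introˡ q) (∨-introˡ q)
  ... | inj₂ q = ∧-intro
    (∨-introʳ (below-mono (λ _ r → proj₁ (∧-true r)) G q))
    (∨-introʳ (below-mono (λ _ r → proj₂ (∧-true r)) G q))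
  below-shift zero    f (false ∷ false ∷ G) p with ∨-true p
  ... | inj₁ q with ∨-true q
  ...   | inj₁ r = ∨-introˡ (∨-introˡ r)
  ...   | inj₂ r with ∨-true (below-∨ (λ F → f (true ∷ false ∷ F)) (λ F → f (false ∷ true ∷ F)) G r)
  ...     | inj₁ s = ∨-introˡ (∨-introʳ s)
  ...     | inj₂ s = ∨-introʳ (∨-introˡ s)
  below-shift zero    f (false ∷ false ∷ G) p | inj₂ q with ∨-true q
  ...   | inj₁ r = ∨-introˡ (∨-introʳ (below-mono (λ _ s → proj₁ (∧-true s)) G r))
  ...   | inj₂ r = ∨-introʳ (∨-introʳ r)
  below-shift (suc i) f (true ∷ G)  p = below-shift i (λ F → f (true ∷ F)) G p
  below-shift (suc i) f (false ∷ G) p with ∨-true p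
  ... | inj₁ q = shift-mono i (λ _ → ∨-introˡ) G (below-shift i (λ F → f (true ∷ F)) G q)
  ... | inj₂ q = shift-mono i (λ _ → ∨-introʳ) G (below-shift i (λ F → f (false ∷ F)) G q)

  -- An arbitrary predicate on sizes instead of a fixed level: in the section of sets that contain
  -- the first element, `c` is replaced by its composition with `suc`.
  restrict : (ℕ → Bool) → BoolFam n → BoolFam n
  restrict c f F = c ∣ F ∣ and f F

  restrict-shift : ∀ i c (f : BoolFam n) → restrict c (shift i f) ⊑ shift i (restrict c f)
  restrict-shift i    c f []                   p = p
  restrict-shift zero c f (a ∷ [])             p = p
  restrict-shift zero c f (true ∷ true ∷ F)    p = p
  restrict-shift zero c f (true ∷ false ∷ F)   p with ∧-true p
  ... | q , r with ∨-true r
  ...   | inj₁ s = ∨-introˡ (∧-intro q s)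
  ...   | inj₂ s = ∨-introʳ (∧-intro q s)
  restrict-shift zero c f (false ∷ true ∷ F)   p with ∧-true p
  ... | q , r = ∧-intro (∧-intro q (proj₁ (∧-true r))) (∧-intro q (proj₂ (∧-true r)))
  restrict-shift zero c f (false ∷ false ∷ F)  p = p
  restrict-shift (suc i) c f (true ∷ F)        p = restrict-shift i (λ x → c (suc x)) (λ F → f (true ∷ F)) F p
  restrict-shift (suc i) c f (false ∷ F)       p = restrict-shift i c (λ F → f (false ∷ F)) F p

  cnt-below-shift : ∀ i c (f : BoolFam n) → cnt (restrict c (below (shift i f))) ≤ cnt (restrict c (below f))
  cnt-below-shift i c f = ≤-trans
    (cnt-mono (λ F p → restrict-shift i c (below f) F
      (∧-intro (proj₁ (∧-true p)) (below-shift i f F (proj₂ (∧-true p))))))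
    (≤-reflexive (cnt-shift i (restrict c (below f))))

  -- Stable families

  Stable : BoolFam n → Set
  Stable {zero}        f = ⊤
  Stable {suc zero}    f = ⊤
  Stable {suc (suc n)} f = (∀ F → f ∋ false ∷ true ∷ F → f ∋ true ∷ false ∷ F)
                         × (∀ a → Stable (λ F → f (a ∷ F)))

  positionSum : ℕ → Subset n → ℕ
  positionSum c []          = 0
  positionSum c (true ∷ F)  = c + positionSum (suc c) F
  positionSum c (false ∷ F) = positionSum (suc c) F

  -- The potential that makes repeated shifting terminate. In the recursion `c` is the index of the
  -- first remaining coordinate and `d` the sum of the positions already passed.
  weight : ℕ → ℕ → BoolFam n → ℕ
  weight d c f = ∑ (λ F → ⟦ f F ⟧ * (d + positionSum c F))

  -- The number of members that the shift really moves, which is also the drop of the weight.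
  defect : ℕ → BoolFam n → ℕ
  defect {zero}        i       f = 0
  defect {suc n}       (suc i) f = defect i (λ F → f (true ∷ F)) + defect i (λ F → f (false ∷ F))
  defect {suc zero}    zero    f = 0
  defect {suc (suc n)} zero    f = cnt (λ F → f (false ∷ true ∷ F) and not (f (true ∷ false ∷ F)))

  weight-true : ∀ d c (f : BoolFam n) →
    ∑ (λ F → ⟦ f F ⟧ * (d + (c + positionSum (suc c) F))) ≡ weight (d + c) (suc c) f
  weight-true d c f = ∑-cong (λ F → cong (⟦ f F ⟧ *_) (sym (+-assoc d c (positionSum (suc c) F))))

  weight-shift : ∀ i d c (f : BoolFam n) → weight d c (shift i f) + defect i f ≡ weight d c f
  weight-shift {zero}        i       d c f = +-identityʳ _
  weight-shift {suc zero}    zero    d c f = +-identityʳ _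
  weight-shift {suc (suc n)} zero    d c f = begin
    (x₁ + ∑ u) + (∑ v + x₄) + ∑ z           ≡⟨ middle x₁ (∑ u) (∑ v) x₄ (∑ z) ⟩
    (x₁ + x₄) + (∑ u + ∑ v + ∑ z)           ≡⟨ cong ((x₁ + x₄) +_) swapped ⟩
    (x₁ + x₄) + (∑ p + ∑ q)                 ≡⟨ outer x₁ x₄ (∑ p) (∑ q) ⟩
    (x₁ + ∑ p) + (∑ q + x₄)                 ∎
    where
    open ≡-Reasoning
    f₁₀ f₀₁ : BoolFam n
    f₁₀ F = f (true ∷ false ∷ F)
    f₀₁ F = f (false ∷ true ∷ F)
    y : Subset n → ℕ
    y F = d + (c + positionSum (2 + c) F)
    y′ : Subset n → ℕ
    y′ F = d + (suc c + positionSum (2 + c) F)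
    u v z p q : Subset n → ℕ
    u F = ⟦ f₁₀ F or f₀₁ F ⟧ * y F
    v F = ⟦ f₁₀ F and f₀₁ F ⟧ * y′ F
    z F = ⟦ f₀₁ F and not (f₁₀ F) ⟧
    p F = ⟦ f₁₀ F ⟧ * y F
    q F = ⟦ f₀₁ F ⟧ * y′ F
    x₁ = ∑ (λ (F : Subset n) → ⟦ f (true ∷ true ∷ F) ⟧ * (d + positionSum c (true ∷ true ∷ F)))
    x₄ = ∑ (λ (F : Subset n) → ⟦ f (false ∷ false ∷ F) ⟧ * (d + positionSum c (false ∷ false ∷ F)))
    middle : ∀ a b c d e → (a + b) + (c + d) + e ≡ (a + d) + (b + c + e)
    middle = solve-∀
    outer : ∀ a b c d → (a + b) + (c + d) ≡ (a + c) + (d + b)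
    outer = solve-∀
    pointwise : ∀ F → u F + v F + z F ≡ p F + q F
    pointwise F rewrite +-suc d (c + positionSum (2 + c) F) = swap-weight (f₁₀ F) (f₀₁ F) (y F)
    swapped : ∑ u + ∑ v + ∑ z ≡ ∑ p + ∑ q
    swapped = trans (cong (_+ ∑ z) (sym (∑-+ u v)))
      (trans (sym (∑-+ (λ F → u F + v F) z)) (trans (∑-cong pointwise) (∑-+ p q)))
  weight-shift {suc n} (suc i) d c f = begin
    (∑ (λ F → ⟦ shift i f₁ F ⟧ * (d + (c + positionSum (suc c) F))) + weight d (suc c) (shift i f₀))
      + (defect i f₁ + defect i f₀)
      ≡⟨ cong (λ x → x + weight d (suc c) (shift i f₀) + (defect i f₁ + defect i f₀))
              (weight-true d c (shift i f₁)) ⟩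
    (weight (d + c) (suc c) (shift i f₁) + weight d (suc c) (shift i f₀)) + (defect i f₁ + defect i f₀)
      ≡⟨ +-interchange (weight (d + c) (suc c) (shift i f₁)) _ _ _ ⟩
    (weight (d + c) (suc c) (shift i f₁) + defect i f₁) + (weight d (suc c) (shift i f₀) + defect i f₀)
      ≡⟨ cong₂ _+_ (trans (weight-shift i (d + c) (suc c) f₁) (sym (weight-true d c f₁)))
                   (weight-shift i d (suc c) f₀) ⟩
    weight d c f ∎
    where
    open ≡-Reasoning
    f₁ f₀ : BoolFam n
    f₁ F = f (true ∷ F)
    f₀ F = f (false ∷ F)

  stable-or-defect : (f : BoolFam n) → Stable f ⊎ ∃[ i ] 0 < defect i f
  stable-or-defect {zero}        f = inj₁ tt
  stable-or-defect {suc zero}    f = inj₁ tt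
  stable-or-defect {suc (suc n)} f
    with defect 0 f ≟ 0
       | stable-or-defect (λ F → f (true ∷ F))
       | stable-or-defect (λ F → f (false ∷ F))
  ... | no ≢0  | _             | _             = inj₂ (0 , n≢0⇒n>0 ≢0)
  ... | yes _  | inj₂ (i , lt) | _             = inj₂ (suc i , m≤n⇒m≤n+o _ lt)
  ... | yes _  | inj₁ _        | inj₂ (i , lt) = inj₂ (suc i , m≤n⇒m≤o+n _ lt)
  ... | yes ≡0 | inj₁ s₁       | inj₁ s₀       = inj₁
    ((λ F → ⟦and-not⟧≡0 (∑≡0 ≡0 F)) , λ { true → s₁ ; false → s₀ })

  infix 4 _⇝_
  data _⇝_ {n} : BoolFam n → BoolFam n → Set where
    done : ∀ {f} → f ⇝ f
    step : ∀ {f g} i → shift i f ⇝ g → f ⇝ g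

  stabilise : (f : BoolFam n) → ∃[ g ] Stable g × f ⇝ g
  stabilise f = go f (<-wellFounded _)
    where
    go : ∀ f → Acc _<_ (weight 0 0 f) → ∃[ g ] Stable g × f ⇝ g
    go f (acc rec) with stable-or-defect f
    ... | inj₁ s = f , s , done
    ... | inj₂ (i , lt) =
      let g , s , r = go (shift i f) (rec lighter) in g , s , step i r
      where
      lighter : weight 0 0 (shift i f) < weight 0 0 f
      lighter = subst (weight 0 0 (shift i f) <_) (weight-shift i 0 0 f)
        (m<m+n (weight 0 0 (shift i f)) lt)

  ⇝-cnt : {f g : BoolFam n} → f ⇝ g → cnt g ≡ cnt f
  ⇝-cnt done       = refl
  ⇝-cnt {f = f} (step i r) = trans (⇝-cnt r) (cnt-shift i f)

  ⇝-uniform : {f g : BoolFam n} → f ⇝ g → Uniform k f → Uniform k g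
  ⇝-uniform done       u = u
  ⇝-uniform (step i r) u = ⇝-uniform r (shift-uniform i u)

  ⇝-crossInt : ∀ {t} {f g : BoolFam n} → f ⇝ g → CrossInt t 0 f f → CrossInt t 0 g g
  ⇝-crossInt done       c = c
  ⇝-crossInt (step i r) c = ⇝-crossInt r (shift-crossInt i 0 _ _ c)

  ⇝-below : ∀ {f g : BoolFam n} c → f ⇝ g → cnt (restrict c (below g)) ≤ cnt (restrict c (below f))
  ⇝-below c done       = ≤-refl
  ⇝-below {f = f} c (step i r) = ≤-trans (⇝-below c r) (cnt-below-shift i c f)

  -- The net effect is that the first common element of `F` and `G` moves to the front. Since only
  -- adjacent swaps are available, an element of `F` outside `G` met on the way moves to the front
  -- itself, and the recursion refills the gap that it leaves.
  moveToFront : ∀ (f : BoolFam (suc n)) → Stable f → ∀ F G t → f ∋ false ∷ F → suc t ≤ ∣ F ∩ G ∣ →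
                ∃[ F′ ] f ∋ true ∷ F′ × suc ∣ F′ ∩ G ∣ ≡ ∣ F ∩ G ∣
  moveToFront {zero}  f s [] [] t p ()
  moveToFront {suc n} f (s₀ , s) (true ∷ F)  (true ∷ G) t p lt = false ∷ F , s₀ F p , refl
  moveToFront {suc n} f (s₀ , s) (true ∷ F)  (false ∷ G) t p lt =
    let F′ , q , eq = moveToFront (λ F → f (true ∷ F)) (s true) F G t (s₀ F p) lt in
    true ∷ F′ , q , eq
  moveToFront {suc n} f (s₀ , s) (false ∷ F) (b ∷ G) t p lt =
    let F′ , q , eq = moveToFront (λ F → f (false ∷ F)) (s false) F G t p lt in
    false ∷ F′ , s₀ F′ q , eq

  stable-tail : ∀ (f : BoolFam (suc n)) → Stable f → ∀ a → Stable (λ F → f (a ∷ F))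
  stable-tail {zero}  f s       a = tt
  stable-tail {suc n} f (_ , s) a = s a

  pre : ℕ → Subset n → ℕ
  pre zero    F           = 0
  pre (suc m) []          = 0
  pre (suc m) (true ∷ F)  = suc (pre m F)
  pre (suc m) (false ∷ F) = pre m F

  -- In a column where both sets have a 1, and only there, the intersection grows;
  -- a column of two 0s lets one common element further right be moved away.
  dense-prefix-or-small-∩ : ∀ t (f g : BoolFam n) → Stable f → ∀ F G → f ∋ F → g ∋ G →
    (∃[ m ] m + t ≤ pre m F + pre m G) ⊎ (∃[ F′ ] ∃[ G′ ] f ∋ F′ × g ∋ G′ × ∣ F′ ∩ G′ ∣ < t)
  dense-prefix-or-small-∩ zero    f g s F  G  p q = inj₁ (0 , z≤n)
  dense-prefix-or-small-∩ (suc t) f g s [] [] p q = inj₂ ([] , [] , p , q , s≤s z≤n)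
  dense-prefix-or-small-∩ (suc t) f g s (true ∷ F) (true ∷ G) p q
    with dense-prefix-or-small-∩ t _ (λ G → g (true ∷ G)) (stable-tail f s true) F G p q
  ... | inj₁ (m , le) = inj₁ (suc m , subst₂ _≤_ (sym (+-suc (suc m) t)) (sym (+-suc (suc (pre m F)) (pre m G))) (s≤s (s≤s le)))
  ... | inj₂ (F′ , G′ , p′ , q′ , lt) = inj₂ (true ∷ F′ , true ∷ G′ , p′ , q′ , s≤s lt)
  dense-prefix-or-small-∩ t@(suc _) f g s (true ∷ F) (false ∷ G) p q
    with dense-prefix-or-small-∩ t _ (λ G → g (false ∷ G)) (stable-tail f s true) F G p q
  ... | inj₁ (m , le) = inj₁ (suc m , s≤s le)
  ... | inj₂ (F′ , G′ , p′ , q′ , lt) = inj₂ (true ∷ F′ , false ∷ G′ , p′ , q′ , lt)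
  dense-prefix-or-small-∩ t@(suc _) f g s (false ∷ F) (true ∷ G) p q
    with dense-prefix-or-small-∩ t _ (λ G → g (true ∷ G)) (stable-tail f s false) F G p q
  ... | inj₁ (m , le) = inj₁ (suc m , subst (suc (m + t) ≤_) (sym (+-suc (pre m F) (pre m G))) (s≤s le))
  ... | inj₂ (F′ , G′ , p′ , q′ , lt) = inj₂ (false ∷ F′ , true ∷ G′ , p′ , q′ , lt)
  dense-prefix-or-small-∩ (suc t) f g s (false ∷ F) (false ∷ G) p q
    with dense-prefix-or-small-∩ (suc (suc t)) _ (λ G → g (false ∷ G)) (stable-tail f s false) F G p q
  ... | inj₁ (m , le) = inj₁ (suc m , subst (_≤ pre m F + pre m G) (+-suc m (suc t)) le)
  ... | inj₂ (F′ , G′ , p′ , q′ , lt) with ∣ F′ ∩ G′ ∣ <? suc t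
  ...   | yes lt′ = inj₂ (false ∷ F′ , false ∷ G′ , p′ , q′ , lt′)
  ...   | no ≮ = let F″ , p″ , eq = moveToFront f s F′ G′ t p′ (≮⇒≥ ≮) in
    inj₂ (true ∷ F″ , false ∷ G′ , p″ , q′ , ≤-pred (subst (λ x → suc x ≤ suc (suc t)) (sym eq) lt))

  dense-prefix : ∀ {t} {f : BoolFam n} → Stable f → CrossInt t 0 f f → ∀ F G → f ∋ F → f ∋ G →
                 ∃[ m ] m + t ≤ pre m F + pre m G
  dense-prefix {t = t} {f} s c F G p q with dense-prefix-or-small-∩ t f f s F G p q
  ... | inj₁ r = r
  ... | inj₂ (F′ , G′ , p′ , q′ , lt) = ⊥-elim (<⇒≱ lt (c F′ G′ p′ q′))

  pre≤m : ∀ m (F : Subset n) → pre m F ≤ m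
  pre≤m zero    F           = z≤n
  pre≤m (suc m) []          = z≤n
  pre≤m (suc m) (true ∷ F)  = s≤s (pre≤m m F)
  pre≤m (suc m) (false ∷ F) = m≤n⇒m≤1+n (pre≤m m F)

  pre≤∣F∣ : ∀ m (F : Subset n) → pre m F ≤ ∣ F ∣
  pre≤∣F∣ zero    F           = z≤n
  pre≤∣F∣ (suc m) []          = z≤n
  pre≤∣F∣ (suc m) (true ∷ F)  = s≤s (pre≤∣F∣ m F)
  pre≤∣F∣ (suc m) (false ∷ F) = pre≤∣F∣ m F

  pre-mono : ∀ {m m′} (F : Subset n) → m ≤ m′ → pre m F ≤ pre m′ F
  pre-mono F           z≤n     = z≤n
  pre-mono []          (s≤s p) = z≤n
  pre-mono (true ∷ F)  (s≤s p) = s≤s (pre-mono F p)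
  pre-mono (false ∷ F) (s≤s p) = pre-mono F p

  pre-growth : ∀ m d (F : Subset n) → pre (m + d) F ≤ pre m F + d
  pre-growth zero    d F           = pre≤m d F
  pre-growth (suc m) d []          = z≤n
  pre-growth (suc m) d (true ∷ F)  = s≤s (pre-growth m d F)
  pre-growth (suc m) d (false ∷ F) = pre-growth m d F

  -- Shadows that only lose elements of an initial segment

  del : ℕ → BoolFam n → BoolFam n
  del zero    f G           = false
  del (suc m) f []          = false
  del (suc m) f (true ∷ G)  = del m (λ F → f (true ∷ F)) G
  del (suc m) f (false ∷ G) = del m (λ F → f (false ∷ F)) G or f (true ∷ G)

  del^ : ℕ → ℕ → BoolFam n → BoolFam n
  del^ m zero    f = f
  del^ m (suc j) f = del m (del^ m j f)

  del-mono : ∀ {m m′} {f g : BoolFam n} → m ≤ m′ → f ⊑ g → del m f ⊑ del m′ g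
  del-mono (s≤s p) le (true ∷ G)  q = del-mono p (λ F → le (true ∷ F)) G q
  del-mono (s≤s p) le (false ∷ G) q with ∨-true q
  ... | inj₁ r = ∨-introˡ (del-mono p (λ F → le (false ∷ F)) G r)
  ... | inj₂ r = ∨-introʳ (le _ r)

  del^-mono : ∀ {m m′} j {f g : BoolFam n} → m ≤ m′ → f ⊑ g → del^ m j f ⊑ del^ m′ j g
  del^-mono zero    p le = le
  del^-mono (suc j) p le = del-mono p (del^-mono j p le)

  del-below : ∀ m (f : BoolFam n) → del m f ⊑ below f
  del-below (suc m) f (true ∷ G)  p = del-below m (λ F → f (true ∷ F)) G p
  del-below (suc m) f (false ∷ G) p with ∨-true p
  ... | inj₁ q = ∨-introʳ (del-below m (λ F → f (false ∷ F)) G q)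
  ... | inj₂ q = ∨-introˡ (below-extensive (λ F → f (true ∷ F)) G q)

  del^-below : ∀ m j (f : BoolFam n) → del^ m j f ⊑ below f
  del^-below m zero    f = below-extensive f
  del^-below m (suc j) f G p =
    below-idem f G (below-mono (del^-below m j f) G (del-below m (del^ m j f) G p))

  -- The count is given for every prefix that contains [m]: the disjointness of two shadows is read
  -- off in a prefix longer than the one in which elements are deleted.
  del-∋ : ∀ m (f : BoolFam n) G → del m f ∋ G →
          ∃[ F ] f ∋ F × (∀ {m′} → m ≤ m′ → pre m′ F ≡ suc (pre m′ G)) × ∣ F ∣ ≡ suc ∣ G ∣
  del-∋ (suc m) f (true ∷ G) p =
    let F , q , eq , size = del-∋ m (λ F → f (true ∷ F)) G p in
    true ∷ F , q , (λ { (s≤s le) → cong suc (eq le) }) , cong suc size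
  del-∋ (suc m) f (false ∷ G) p with ∨-true p
  ... | inj₁ r =
    let F , q , eq , size = del-∋ m (λ F → f (false ∷ F)) G r in
    false ∷ F , q , (λ { (s≤s le) → eq le }) , size
  ... | inj₂ r = true ∷ G , r , (λ { (s≤s le) → refl }) , refl

  del^-∋ : ∀ m j (f : BoolFam n) G → del^ m j f ∋ G →
           ∃[ F ] f ∋ F × (∀ {m′} → m ≤ m′ → pre m′ F ≡ j + pre m′ G) × ∣ F ∣ ≡ j + ∣ G ∣
  del^-∋ m zero    f G p = G , p , (λ _ → refl) , refl
  del^-∋ m (suc j) f G p =
    let F′ , p′ , eq′ , size′ = del-∋ m (del^ m j f) G p
        F , q , eq , size = del^-∋ m j f F′ p′
    in F , q , (λ le → trans (eq le) (trans (cong (j +_) (eq′ le)) (+-suc j _)))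
         , trans size (trans (cong (j +_) size′) (+-suc j _))

  ⟦or⟧-weight : ∀ a b x → ⟦ b ⟧ + ⟦ a ⟧ * x ≤ ⟦ a or b ⟧ * suc x
  ⟦or⟧-weight true b x = begin
    ⟦ b ⟧ + 1 * x          ≤⟨ +-monoˡ-≤ (1 * x) (⟦⟧-mono {b} {true} (λ _ → refl)) ⟩
    1 + 1 * x              ≡⟨ *-suc 1 x ⟨
    1 * suc x              ≡⟨ cong (λ c → ⟦ c ⟧ * suc x) (∨-introˡ {true} {b} refl) ⟨
    ⟦ true or b ⟧ * suc x  ∎
    where open ≤-Reasoning
  ⟦or⟧-weight false true x = begin
    1                         ≤⟨ s≤s z≤n ⟩
    1 * suc x                 ≡⟨ cong (λ c → ⟦ c ⟧ * suc x) (∨-introʳ {false} {true} refl) ⟨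
    ⟦ false or true ⟧ * suc x ∎
    where open ≤-Reasoning
  ⟦or⟧-weight false false x = z≤n

  -- Double counting of the pairs in which G arises from F by deleting one element of [m]: F has
  -- `pre m F` such G, and G has at most `m ∸ pre m G` such F. The induction never forms the pairs;
  -- deletion of the first element contributes the term `cnt f₁`.
  del-doubleCount : ∀ m (f : BoolFam n) →
                    ∑ (λ F → ⟦ f F ⟧ * pre m F) ≤ ∑ (λ G → ⟦ del m f G ⟧ * (m ∸ pre m G))
  del-doubleCount {n} zero f =
    ≤-trans (≤-reflexive (trans (∑-cong (λ F → *-zeroʳ ⟦ f F ⟧)) (∑-0 {n}))) z≤n
  del-doubleCount {zero}  (suc m) f = ≤-reflexive (*-zeroʳ ⟦ f [] ⟧)
  del-doubleCount {suc n} (suc m) f = begin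
    ∑ (λ F → ⟦ f₁ F ⟧ * suc (pre m F)) + ∑ (λ F → ⟦ f₀ F ⟧ * pre m F)
      ≡⟨ cong (_+ ∑ (λ F → ⟦ f₀ F ⟧ * pre m F))
           (trans (∑-cong (λ F → *-suc ⟦ f₁ F ⟧ (pre m F))) (∑-+ (λ F → ⟦ f₁ F ⟧) _)) ⟩
    (cnt f₁ + ∑ (λ F → ⟦ f₁ F ⟧ * pre m F)) + ∑ (λ F → ⟦ f₀ F ⟧ * pre m F)
      ≤⟨ +-mono-≤ (+-monoʳ-≤ (cnt f₁) (del-doubleCount m f₁)) (del-doubleCount m f₀) ⟩
    (cnt f₁ + ∑ (λ G → ⟦ del m f₁ G ⟧ * (m ∸ pre m G))) + ∑ (λ G → ⟦ del m f₀ G ⟧ * (m ∸ pre m G))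
      ≡⟨ rotate (cnt f₁) _ _ ⟩
    ∑ (λ G → ⟦ del m f₁ G ⟧ * (m ∸ pre m G)) + (cnt f₁ + ∑ (λ G → ⟦ del m f₀ G ⟧ * (m ∸ pre m G)))
      ≡⟨ cong (∑ (λ G → ⟦ del m f₁ G ⟧ * (m ∸ pre m G)) +_) (∑-+ (λ F → ⟦ f₁ F ⟧) _) ⟨
    ∑ (λ G → ⟦ del m f₁ G ⟧ * (m ∸ pre m G)) + ∑ (λ G → ⟦ f₁ G ⟧ + ⟦ del m f₀ G ⟧ * (m ∸ pre m G))
      ≤⟨ +-monoʳ-≤ _ (∑-mono pointwise) ⟩
    ∑ (λ G → ⟦ del m f₁ G ⟧ * (m ∸ pre m G)) + ∑ (λ G → ⟦ del m f₀ G or f₁ G ⟧ * (suc m ∸ pre m G))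
      ∎
    where
    open ≤-Reasoning
    f₁ f₀ : BoolFam n
    f₁ F = f (true ∷ F)
    f₀ F = f (false ∷ F)
    rotate : ∀ a b c → (a + b) + c ≡ b + (a + c)
    rotate = solve-∀
    pointwise : ∀ G → ⟦ f₁ G ⟧ + ⟦ del m f₀ G ⟧ * (m ∸ pre m G)
                    ≤ ⟦ del m f₀ G or f₁ G ⟧ * (suc m ∸ pre m G)
    pointwise G rewrite +-∸-assoc 1 (pre≤m m G) = ⟦or⟧-weight (del m f₀ G) (f₁ G) (m ∸ pre m G)

  -- The local LYM inequality inside [m]. A set in the shadow keeps at least `b` elements of [m], so
  -- at most `m ∸ b` elements can be added back.
  cnt-del : ∀ m b (f : BoolFam n) → (∀ F → f ∋ F → suc b ≤ pre m F) →
            cnt f * suc b ≤ cnt (del m f) * (m ∸ b)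
  cnt-del m b f dense = begin
    cnt f * suc b                            ≡⟨ ∑-*ʳ (λ F → ⟦ f F ⟧) (suc b) ⟨
    ∑ (λ F → ⟦ f F ⟧ * suc b)                ≤⟨ ∑-mono (λ F → onMembers (f F) (dense F)) ⟩
    ∑ (λ F → ⟦ f F ⟧ * pre m F)              ≤⟨ del-doubleCount m f ⟩
    ∑ (λ G → ⟦ del m f G ⟧ * (m ∸ pre m G))  ≤⟨ ∑-mono (λ G → onMembers (del m f G) (codegree G)) ⟩
    ∑ (λ G → ⟦ del m f G ⟧ * (m ∸ b))        ≡⟨ ∑-*ʳ (λ G → ⟦ del m f G ⟧) (m ∸ b) ⟩
    cnt (del m f) * (m ∸ b)                  ∎
    where
    open ≤-Reasoning
    onMembers : ∀ c {x y} → (c ≡ true → x ≤ y) → ⟦ c ⟧ * x ≤ ⟦ c ⟧ * y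
    onMembers true  h = *-monoʳ-≤ 1 (h refl)
    onMembers false h = z≤n
    codegree : ∀ G → del m f ∋ G → m ∸ pre m G ≤ m ∸ b
    codegree G p = let F , q , eq , _ = del-∋ m f G p in
      ∸-monoʳ-≤ m (≤-pred (subst (suc b ≤_) (eq ≤-refl) (dense F q)))

  -- Binomial coefficients

  [1+k]*nC[1+k] : ∀ n k → suc k * (n C suc k) ≡ (n ∸ k) * (n C k)
  [1+k]*nC[1+k] zero k rewrite k>n⇒nCk≡0 {0} {suc k} (s≤s z≤n) | 0∸n≡0 k = *-zeroʳ (suc k)
  [1+k]*nC[1+k] (suc n) zero rewrite nC1≡n (suc n) = *-comm 1 (suc n)
  [1+k]*nC[1+k] (suc n) (suc k) = begin
    suc (suc k) * (suc n C suc (suc k))               ≡⟨ cong (suc (suc k) *_) (nCk+nC[k+1]≡[n+1]C[k+1] n (suc k)) ⟨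
    suc (suc k) * (x + (n C suc (suc k)))             ≡⟨ *-distribˡ-+ (suc (suc k)) x _ ⟩
    suc (suc k) * x + suc (suc k) * (n C suc (suc k)) ≡⟨ cong (suc (suc k) * x +_) ([1+k]*nC[1+k] n (suc k)) ⟩
    suc (suc k) * x + (n ∸ suc k) * x                 ≡⟨ balance ⟩
    suc k * x + (n ∸ k) * x                           ≡⟨ cong (_+ (n ∸ k) * x) ([1+k]*nC[1+k] n k) ⟩
    (n ∸ k) * (n C k) + (n ∸ k) * x                   ≡⟨ *-distribˡ-+ (n ∸ k) (n C k) x ⟨
    (n ∸ k) * ((n C k) + x)                           ≡⟨ cong ((n ∸ k) *_) (nCk+nC[k+1]≡[n+1]C[k+1] n k) ⟩
    (n ∸ k) * (suc n C suc k)                         ∎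
    where
    open ≡-Reasoning
    x = n C suc k
    shuffle : ∀ k e x → suc (suc k) * x + e * x ≡ suc k * x + suc e * x
    shuffle = solve-∀
    balance : suc (suc k) * x + (n ∸ suc k) * x ≡ suc k * x + (n ∸ k) * x
    balance with suc k ≤? n
    ... | yes k<n = trans (shuffle k (n ∸ suc k) x)
                          (cong (λ e → suc k * x + e * x) (sym (+-∸-assoc 1 k<n)))
    ... | no k≮n rewrite k>n⇒nCk≡0 {n} {suc k} (≰⇒> k≮n) | *-zeroʳ k | *-zeroʳ (n ∸ suc k) | *-zeroʳ (n ∸ k) = refl

  -- Iterated local LYM. The induction first goes down to `suc b` elements in [m] and then deletes
  -- one more; the factors (b + 1) / (m - b) telescope to the quotient of binomial coefficients.
  cnt-del^ : ∀ m j b (f : BoolFam n) → (∀ F → f ∋ F → j + b ≤ pre m F) → j + b ≤ m →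
             cnt f * (m C b) ≤ cnt (del^ m j f) * (m C (j + b))
  cnt-del^ m zero    b f dense le = ≤-refl
  cnt-del^ m (suc j) b f dense le = *-cancelʳ-≤ _ _ (m ∸ b) {{>-nonZero (m<n⇒0<n∸m b<m)}} (begin
    cnt f * (m C b) * (m ∸ b)                  ≡⟨ lemma₁ (cnt f) (m C b) (m ∸ b) ⟩
    cnt f * ((m ∸ b) * (m C b))                ≡⟨ cong (cnt f *_) ([1+k]*nC[1+k] m b) ⟨
    cnt f * (suc b * (m C suc b))              ≡⟨ lemma₂ (cnt f) (suc b) (m C suc b) ⟩
    cnt f * (m C suc b) * suc b                ≤⟨ *-monoˡ-≤ (suc b) (cnt-del^ m j (suc b) f dense′ (subst (_≤ m) j+b le)) ⟩
    cnt h * (m C (j + suc b)) * suc b          ≡⟨ cong (λ x → cnt h * (m C x) * suc b) (+-suc j b) ⟩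
    cnt h * (m C (suc j + b)) * suc b          ≡⟨ lemma₃ (cnt h) (m C (suc j + b)) (suc b) ⟩
    cnt h * suc b * (m C (suc j + b))          ≤⟨ *-monoˡ-≤ (m C (suc j + b)) (cnt-del m b h denseʰ) ⟩
    cnt (del m h) * (m ∸ b) * (m C (suc j + b)) ≡⟨ lemma₃ (cnt (del m h)) (m ∸ b) (m C (suc j + b)) ⟩
    cnt (del m h) * (m C (suc j + b)) * (m ∸ b) ∎)
    where
    open ≤-Reasoning
    h = del^ m j f
    j+b : suc j + b ≡ j + suc b
    j+b = sym (+-suc j b)
    b<m : b < m
    b<m = ≤-trans (s≤s (m≤n+m b j)) le
    dense′ : ∀ F → f ∋ F → j + suc b ≤ pre m F
    dense′ F p = subst (_≤ pre m F) j+b (dense F p)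
    denseʰ : ∀ G → h ∋ G → suc b ≤ pre m G
    denseʰ G p = let F , q , eq , _ = del^-∋ m j f G p in
      +-cancelˡ-≤ j _ _ (subst (j + suc b ≤_) (eq ≤-refl) (dense′ F q))
    lemma₁ : ∀ x y z → x * y * z ≡ x * (z * y)
    lemma₁ = solve-∀
    lemma₂ : ∀ x y z → x * (y * z) ≡ x * z * y
    lemma₂ = solve-∀
    lemma₃ : ∀ x y z → x * y * z ≡ x * z * y
    lemma₃ = solve-∀

  belowThreshold aboveThreshold : ℕ → ℕ → BoolFam n → BoolFam n
  belowThreshold M a f F = f F and does (pre M F <? a)
  aboveThreshold M a f F = f F and not (does (pre M F <? a))

  -- Deleting from an initial segment keeps sets with different numbers of
  -- elements in a longer one apart.
  cnt-del^-split : ∀ {m M} j a (f : BoolFam n) → m ≤ M →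
    cnt (del^ m j (belowThreshold M a f)) + cnt (del^ M j (aboveThreshold M a f)) ≤ cnt (del^ M j f)
  cnt-del^-split {m = m} {M} j a f m≤M = cnt-disjoint
    {f = del^ m j (belowThreshold M a f)} {del^ M j (aboveThreshold M a f)} {del^ M j f}
    (del^-mono j m≤M (λ F p → proj₁ (∧-true p)))
    (del^-mono j ≤-refl (λ F p → proj₁ (∧-true p)))
    (λ G p q →
      let F , F∈ , eq , _ = del^-∋ m j (belowThreshold M a f) G p
          F′ , F′∈ , eq′ , _ = del^-∋ M j (aboveThreshold M a f) G q
      in not-does (pre M F′ <? a) (proj₂ (∧-true F′∈))
           (subst (_< a) (trans (eq m≤M) (sym (eq′ ≤-refl)))
             (true-does (pre M F <? a) (proj₂ (∧-true F∈)))))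

  -- Pseudo-intersecting families

  -- Recursive, so that the next window is two longer by definition, the form in which binomial
  -- coefficients of consecutive windows are compared.
  window : ℕ → ℕ → ℕ
  window s zero    = s
  window s (suc ℓ) = suc (suc (window s ℓ))

  window≡ : ∀ s ℓ → window s ℓ ≡ s + 2 * ℓ
  window≡ s zero    = sym (+-identityʳ s)
  window≡ s (suc ℓ) = trans (cong (λ x → suc (suc x)) (window≡ s ℓ)) (eq s ℓ)
    where
    eq : ∀ s ℓ → suc (suc (s + 2 * ℓ)) ≡ s + 2 * suc ℓ
    eq = solve-∀

  ℓ+s≤window : ∀ s ℓ → ℓ + s ≤ window s ℓ
  ℓ+s≤window s zero    = ≤-refl
  ℓ+s≤window s (suc ℓ) = s≤s (m≤n⇒m≤1+n (ℓ+s≤window s ℓ))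

  Pseudo : ℕ → ℕ → Subset n → Set
  Pseudo s v F = ∃[ ℓ ] ℓ < suc v × ℓ + s ≤ pre (window s ℓ) F

  pseudo? : ∀ s v (F : Subset n) → Dec (Pseudo s v F)
  pseudo? s v F = anyUpTo? (λ ℓ → ℓ + s ≤? pre (window s ℓ) F) (suc v)

  C-square : ∀ {m a} → a ≤ m →
    (suc (suc m) C suc a) * (suc a * (suc m ∸ a)) ≡ (m C a) * (suc (suc m) * suc m)
  C-square {m} {a} a≤m = begin
    x * (suc a * (suc m ∸ a))                    ≡⟨ lemma₁ x (suc a) (suc m ∸ a) ⟩
    (suc a * x) * (suc m ∸ a)                    ≡⟨ cong (_* (suc m ∸ a)) ([1+k]*nC[1+k] (suc (suc m)) a) ⟩
    ((suc (suc m) ∸ a) * (suc (suc m) C a)) * (suc m ∸ a)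
                                                 ≡⟨ cong (_* (suc m ∸ a)) (C-absorb (m≤n⇒m≤1+n a≤m)) ⟩
    (suc (suc m) * (suc m C a)) * (suc m ∸ a)    ≡⟨ lemma₂ (suc (suc m)) (suc m C a) (suc m ∸ a) ⟩
    suc (suc m) * ((suc m ∸ a) * (suc m C a))    ≡⟨ cong (suc (suc m) *_) (C-absorb a≤m) ⟩
    suc (suc m) * (suc m * (m C a))              ≡⟨ lemma₃ (suc (suc m)) (suc m) (m C a) ⟩
    (m C a) * (suc (suc m) * suc m)              ∎
    where
    open ≡-Reasoning
    x = suc (suc m) C suc a
    lemma₁ : ∀ x y z → x * (y * z) ≡ (y * x) * z
    lemma₁ = solve-∀
    lemma₂ : ∀ x y z → (x * y) * z ≡ x * (z * y)
    lemma₂ = solve-∀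
    lemma₃ : ∀ x y z → x * (y * z) ≡ z * (x * y)
    lemma₃ = solve-∀

  -- By `C-square` the growth from C(m, a) to C(m + 2, a + 1) depends on a only through the
  -- denominator (a + 1)(m + 1 - a), so comparing two growths is comparing two such products.
  C-ratio-decreasing : ∀ {m a b} → a ≤ m → b ≤ m →
    suc b * (suc m ∸ b) ≤ suc a * (suc m ∸ a) →
    (suc (suc m) C suc a) * (m C b) ≤ (m C a) * (suc (suc m) C suc b)
  C-ratio-decreasing {m} {a} {b} a≤m b≤m le = *-cancelʳ-≤ _ _ (A * Q) (begin
    X * (m C b) * (A * Q)     ≡⟨ lemma₁ X (m C b) A Q ⟩
    (X * A) * ((m C b) * Q)   ≡⟨ cong₂ _*_ (C-square a≤m) (sym (C-square b≤m)) ⟩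
    ((m C a) * Q) * (Y * B)   ≤⟨ *-monoʳ-≤ ((m C a) * Q) (*-monoʳ-≤ Y le) ⟩
    ((m C a) * Q) * (Y * A)   ≡⟨ lemma₂ (m C a) Q Y A ⟩
    (m C a) * Y * (A * Q)     ∎)
    where
    open ≤-Reasoning
    A = suc a * (suc m ∸ a)
    B = suc b * (suc m ∸ b)
    Q = suc (suc m) * suc m
    X = suc (suc m) C suc a
    Y = suc (suc m) C suc b
    instance
      A≢0 : NonZero A
      A≢0 = m*n≢0 (suc a) (suc m ∸ a) {{_}} {{>-nonZero (m<n⇒0<n∸m (s≤s a≤m))}}
      AQ≢0 : NonZero (A * Q)
      AQ≢0 = m*n≢0 A Q
    lemma₁ : ∀ x y a q → x * y * (a * q) ≡ (x * a) * (y * q)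
    lemma₁ = solve-∀
    lemma₂ : ∀ x q y a → (x * q) * (y * a) ≡ x * y * (a * q)
    lemma₂ = solve-∀

  -- With s = j + u this is γ(v + 1, s, j) ≤ γ(v, s, j) with denominators cleared: a shorter window
  -- gives a better ratio. The two products compared differ by exactly j u.
  window-C-step : ∀ j u v → let m = window (j + u) v in
    (suc (suc m) C suc (v + u)) * (m C (v + (j + u))) ≤ (m C (v + u)) * (suc (suc m) C suc (v + (j + u)))
  window-C-step j u v = C-ratio-decreasing a≤m b≤m (begin
    suc b * (suc m ∸ b)  ≡⟨ cong (suc b *_) (∸-eq b (suc v) (trans m≡ (eq₁ j u v))) ⟩
    suc b * suc v        ≤⟨ m≤m+n _ (j * u) ⟩
    suc b * suc v + j * u ≡⟨ eq₃ j u v ⟩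
    suc a * suc (v + j)  ≡⟨ cong (suc a *_) (∸-eq a (suc (v + j)) (trans m≡ (eq₂ j u v))) ⟨
    suc a * (suc m ∸ a)  ∎)
    where
    open ≤-Reasoning
    m = window (j + u) v
    a = v + u
    b = v + (j + u)
    b≤m : b ≤ m
    b≤m = ℓ+s≤window (j + u) v
    a≤m : a ≤ m
    a≤m = ≤-trans (+-monoʳ-≤ v (m≤n+m u j)) b≤m
    m≡ : suc m ≡ suc (j + u + 2 * v)
    m≡ = cong suc (window≡ (j + u) v)
    ∸-eq : ∀ x y {z} → z ≡ x + y → z ∸ x ≡ y
    ∸-eq x y refl = m+n∸m≡n x y
    eq₁ : ∀ j u v → suc (j + u + 2 * v) ≡ (v + (j + u)) + suc v
    eq₁ = solve-∀
    eq₂ : ∀ j u v → suc (j + u + 2 * v) ≡ (v + u) + suc (v + j)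
    eq₂ = solve-∀
    eq₃ : ∀ j u v → suc (v + (j + u)) * suc v + j * u ≡ suc (v + u) * suc (v + j)
    eq₃ = solve-∀

  ratio-trans : ∀ x y p q p′ q′ .{{_ : NonZero q}} →
                x * p ≤ y * q → p′ * q ≤ p * q′ → x * p′ ≤ y * q′
  ratio-trans x y p q p′ q′ xp≤yq le = *-cancelʳ-≤ _ _ q (begin
    x * p′ * q    ≡⟨ *-assoc x p′ q ⟩
    x * (p′ * q)  ≤⟨ *-monoʳ-≤ x le ⟩
    x * (p * q′)  ≡⟨ *-assoc x p q′ ⟨
    x * p * q′    ≤⟨ *-monoˡ-≤ q′ xp≤yq ⟩
    y * q * q′    ≡⟨ lemma y q q′ ⟩
    y * q′ * q    ∎)
    where
    open ≤-Reasoning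
    lemma : ∀ y q q′ → y * q * q′ ≡ y * q′ * q
    lemma = solve-∀

  -- Induction on the number of windows. Members that are dense in the longest window satisfy local
  -- LYM there; all others have a shorter window, where the ratio is at least as good. The threshold
  -- is the density in the longest window, so the two shadows are disjoint and their sizes add.
  cnt-del^-pseudo : ∀ j u v (f : BoolFam n) → (∀ F → f ∋ F → Pseudo (j + u) v F) →
    let m = window (j + u) v in cnt f * (m C (v + u)) ≤ cnt (del^ m j f) * (m C (v + (j + u)))
  cnt-del^-pseudo j u zero f ps = cnt-del^ (j + u) j u f dense ≤-refl
    where
    dense : ∀ F → f ∋ F → j + u ≤ pre (j + u) F
    dense F p with ps F p
    ... | zero , _ , le = le
    ... | suc _ , s≤s () , _
  cnt-del^-pseudo {n} j u (suc v) f ps = begin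
    cnt f * c                              ≡⟨ cong (_* c) (cnt-split f (λ F → does (pre M F <? a))) ⟩
    (cnt lo + cnt hi) * c                  ≡⟨ *-distribʳ-+ c (cnt lo) (cnt hi) ⟩
    cnt lo * c + cnt hi * c                ≤⟨ +-mono-≤ lo≤ hi≤ ⟩
    cnt (del^ m j lo) * e + cnt (del^ M j hi) * e  ≡⟨ *-distribʳ-+ e (cnt (del^ m j lo)) _ ⟨
    (cnt (del^ m j lo) + cnt (del^ M j hi)) * e    ≤⟨ *-monoˡ-≤ e (cnt-del^-split j a f (m≤n⇒m≤1+n (n≤1+n m))) ⟩
    cnt (del^ M j f) * e                   ∎
    where
    open ≤-Reasoning
    s = j + u
    m = window s v
    M = suc (suc m)
    a = suc v + s
    c = M C (suc v + u)
    e = M C a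
    lo hi : BoolFam n
    lo = belowThreshold M a f
    hi = aboveThreshold M a f
    lo-pseudo : ∀ F → lo ∋ F → Pseudo s v F
    lo-pseudo F p with ps F (proj₁ (∧-true p))
    ... | ℓ , s≤s ℓ≤ , le with m≤n⇒m<n∨m≡n ℓ≤
    ...   | inj₁ ℓ<   = ℓ , ℓ< , le
    ...   | inj₂ refl = ⊥-elim (<⇒≱ (true-does (pre M F <? a) (proj₂ (∧-true p))) le)
    lo≤ : cnt lo * c ≤ cnt (del^ m j lo) * e
    lo≤ = ratio-trans (cnt lo) (cnt (del^ m j lo)) (m C (v + u)) (m C (v + s)) c e
      {{C-nonZero (ℓ+s≤window s v)}}
      (cnt-del^-pseudo j u v lo lo-pseudo) (window-C-step j u v)
    a≡ : j + (suc v + u) ≡ a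
    a≡ = eq j v u
      where
      eq : ∀ j v u → j + (suc v + u) ≡ suc v + (j + u)
      eq = solve-∀
    hi-dense : ∀ F → hi ∋ F → j + (suc v + u) ≤ pre M F
    hi-dense F p = subst (_≤ pre M F) (sym a≡) (≮⇒≥ (not-does (pre M F <? a) (proj₂ (∧-true p))))
    hi≤ : cnt hi * c ≤ cnt (del^ M j hi) * e
    hi≤ = subst (λ x → cnt hi * c ≤ cnt (del^ M j hi) * (M C x)) a≡
      (cnt-del^ M j (suc v + u) hi hi-dense (subst (_≤ M) (sym a≡) (ℓ+s≤window s (suc v))))

  cnt-del^-pseudo-γ : ∀ {j s} v (f : BoolFam n) → j ≤ s → (∀ F → f ∋ F → Pseudo s v F) →
    cnt f * ((s + 2 * v) C (s + v ∸ j)) ≤ cnt (del^ (window s v) j f) * ((s + 2 * v) C (s + v))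
  cnt-del^-pseudo-γ {j = j} {s} v f j≤s ps
    rewrite sym (window≡ s v) | +-comm s v | +-∸-assoc v j≤s =
    subst (λ x → cnt f * (window x v C (v + u)) ≤ cnt (del^ (window x v) j f) * (window x v C (v + x)))
      j+u≡s
      (cnt-del^-pseudo j u v f (λ F p → subst (λ x → Pseudo x v F) (sym j+u≡s) (ps F p)))
    where
    u = s ∸ j
    j+u≡s : j + u ≡ s
    j+u≡s = m+[n∸m]≡n j≤s

  stable-pseudo : ∀ {t} q {f : BoolFam n} → Stable f → CrossInt t 0 f f → Uniform (t + q) f →
                  ∀ F → f ∋ F → Pseudo t q F
  stable-pseudo {t = t} q {f} st ci un F p = ℓ , s≤s ℓ≤q , dense
    where
    m = proj₁ (dense-prefix st ci F F p p)
    x = pre m F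
    m+t≤2x : m + t ≤ x + x
    m+t≤2x = proj₂ (dense-prefix st ci F F p p)
    t≤x : t ≤ x
    t≤x = +-cancelˡ-≤ m t x (≤-trans m+t≤2x (+-monoˡ-≤ x (pre≤m m F)))
    -- With ℓ = x - t, the inequality m + t ≤ 2x reads m ≤ t + 2ℓ, so the dense prefix fits into the
    -- window; x ≤ |F| = t + q gives ℓ ≤ q.
    ℓ = x ∸ t
    ℓ+t≡x : ℓ + t ≡ x
    ℓ+t≡x = m∸n+n≡m t≤x
    ℓ≤q : ℓ ≤ q
    ℓ≤q = +-cancelʳ-≤ t ℓ q (begin
      ℓ + t  ≡⟨ ℓ+t≡x ⟩
      x      ≤⟨ pre≤∣F∣ m F ⟩
      ∣ F ∣  ≡⟨ un F p ⟩
      t + q  ≡⟨ +-comm t q ⟩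
      q + t  ∎)
      where open ≤-Reasoning
    m≤window : m ≤ window t ℓ
    m≤window = +-cancelʳ-≤ t m (window t ℓ) (begin
      m + t              ≤⟨ m+t≤2x ⟩
      x + x              ≡⟨ cong (λ y → y + y) ℓ+t≡x ⟨
      (ℓ + t) + (ℓ + t)  ≡⟨ eq ℓ t ⟩
      (t + 2 * ℓ) + t    ≡⟨ cong (_+ t) (window≡ t ℓ) ⟨
      window t ℓ + t     ∎)
      where
      open ≤-Reasoning
      eq : ∀ ℓ t → (ℓ + t) + (ℓ + t) ≡ (t + 2 * ℓ) + t
      eq = solve-∀
    dense : ℓ + t ≤ pre (window t ℓ) F
    dense = subst (_≤ pre (window t ℓ) F) (sym ℓ+t≡x) (pre-mono F m≤window)

  -- A prefix that is dense for F and F₀ together is dense for one of them alone.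
  pseudo-dichotomy : ∀ {t} q w {f : BoolFam n} → Stable f → CrossInt t 0 f f → Uniform (t + q) f →
    ∀ F F₀ → f ∋ F → f ∋ F₀ → pre (window t q) F ≤ suc w + t →
    Pseudo (suc t) w F ⊎ Pseudo t (suc w) F₀
  pseudo-dichotomy {t = t} q w {f} st ci un F F₀ p p₀ few = cases (suc t ≤? x)
    where
    open ≤-Reasoning
    m = proj₁ (dense-prefix st ci F F₀ p p₀)
    x = pre m F
    y = pre m F₀
    m+t≤x+y : m + t ≤ x + y
    m+t≤x+y = proj₂ (dense-prefix st ci F F₀ p p₀)
    -- Both sets have size t + q, so the common prefix lies inside the window in which `few` limits
    -- F.
    m≤M : m ≤ window t q
    m≤M = +-cancelʳ-≤ t m (window t q) (begin
      m + t              ≤⟨ m+t≤x+y ⟩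
      x + y              ≤⟨ +-mono-≤ (pre≤∣F∣ m F) (pre≤∣F∣ m F₀) ⟩
      ∣ F ∣ + ∣ F₀ ∣     ≡⟨ cong₂ _+_ (un F p) (un F₀ p₀) ⟩
      (t + q) + (t + q)  ≡⟨ eq t q ⟩
      (t + 2 * q) + t    ≡⟨ cong (_+ t) (window≡ t q) ⟨
      window t q + t     ∎)
      where
      eq : ∀ t q → (t + q) + (t + q) ≡ (t + 2 * q) + t
      eq = solve-∀
    -- Here y ≥ m, so F₀ contains all of [m], and m ≥ t.
    initial : x ≤ t → t ≤ pre t F₀
    initial x≤t = +-cancelʳ-≤ (m ∸ t) t (pre t F₀) (begin
      t + (m ∸ t)           ≡⟨ m+[n∸m]≡n t≤m ⟩
      m                     ≤⟨ m≤y ⟩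
      y                     ≡⟨ cong (λ z → pre z F₀) (m+[n∸m]≡n t≤m) ⟨
      pre (t + (m ∸ t)) F₀  ≤⟨ pre-growth t (m ∸ t) F₀ ⟩
      pre t F₀ + (m ∸ t)    ∎)
      where
      m≤y : m ≤ y
      m≤y = +-cancelʳ-≤ t m y (≤-trans m+t≤x+y (≤-trans (+-monoˡ-≤ y x≤t) (≤-reflexive (+-comm t y))))
      t≤m : t ≤ m
      t≤m = ≤-trans (+-cancelˡ-≤ m t x (≤-trans m+t≤x+y
        (≤-trans (+-monoʳ-≤ x (pre≤m m F₀)) (≤-reflexive (+-comm x m))))) (pre≤m m F)
    -- The length W separates the cases. If m < W, all x = t + 1 + e elements of F in [m] lie in
    -- [t + 1 + 2e]. If m ≥ W, then F₀ misses at most m - y ≤ x - t = e + 1 elements of [m], so it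
    -- has at least W - (e + 1) = t + e + 1 elements in [W].
    e = x ∸ suc t
    W = window t (suc e)
    W≡ : W ≡ suc (window (suc t) e)
    W≡ = trans (window≡ t (suc e)) (trans (eq t e) (cong suc (sym (window≡ (suc t) e))))
      where
      eq : ∀ t e → t + 2 * suc e ≡ suc (suc t + 2 * e)
      eq = solve-∀
    cases : Dec (suc t ≤ x) → Pseudo (suc t) w F ⊎ Pseudo t (suc w) F₀
    cases (no x≯t)  = inj₂ (0 , s≤s z≤n , initial (≤-pred (≰⇒> x≯t)))
    cases (yes x>t) = far (W ≤? m)
      where
      t+1+e≡x : suc t + e ≡ x
      t+1+e≡x = m+[n∸m]≡n x>t
      e≤w : e ≤ w
      e≤w = +-cancelˡ-≤ (suc t) e w (begin
        suc t + e           ≡⟨ t+1+e≡x ⟩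
        x                   ≤⟨ pre-mono F m≤M ⟩
        pre (window t q) F  ≤⟨ few ⟩
        suc w + t           ≡⟨ cong suc (+-comm w t) ⟩
        suc t + w           ∎)
      near : m < W → e + suc t ≤ pre (window (suc t) e) F
      near m<W = ≤-trans (≤-reflexive (trans (+-comm e (suc t)) t+1+e≡x))
        (pre-mono F (≤-pred (subst (m <_) W≡ m<W)))
      dense : W ≤ m → suc e + t ≤ pre W F₀
      dense W≤m = +-cancelʳ-≤ (d + x) (suc e + t) (pre W F₀) (begin
        (suc e + t) + (d + x)            ≡⟨ cong (λ z → (suc e + t) + (d + z)) t+1+e≡x ⟨
        (suc e + t) + (d + (suc t + e))  ≡⟨ eq e t d ⟩
        (t + 2 * suc e + d) + t          ≡⟨ cong (λ z → (z + d) + t) (window≡ t (suc e)) ⟨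
        (W + d) + t                      ≡⟨ cong (_+ t) W+d≡m ⟩
        m + t                            ≤⟨ m+t≤x+y ⟩
        x + y                            ≡⟨ cong (λ z → x + pre z F₀) W+d≡m ⟨
        x + pre (W + d) F₀               ≤⟨ +-monoʳ-≤ x (pre-growth W d F₀) ⟩
        x + (pre W F₀ + d)               ≡⟨ eq′ x (pre W F₀) d ⟩
        pre W F₀ + (d + x)               ∎)
        where
        d = m ∸ W
        W+d≡m : W + d ≡ m
        W+d≡m = m+[n∸m]≡n W≤m
        eq : ∀ e t d → (suc e + t) + (d + (suc t + e)) ≡ (t + 2 * suc e + d) + t
        eq = solve-∀
        eq′ : ∀ x z d → x + (z + d) ≡ z + (d + x)
        eq′ = solve-∀
      far : Dec (W ≤ m) → Pseudo (suc t) w F ⊎ Pseudo t (suc w) F₀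
      far (yes W≤m) = inj₂ (suc e , s≤s (s≤s e≤w) , dense W≤m)
      far (no W≰m)  = inj₁ (e , s≤s e≤w , near (≰⇒> W≰m))

  -- Counting sets by their trace on an initial segment

  cnt-empty : (f : BoolFam n) → (∀ F → f ∋ F → ⊥) → cnt f ≤ 0
  cnt-empty {n} f empty = ≤-trans (cnt-mono {f = f} {λ _ → false} (λ F p → ⊥-elim (empty F p))) (≤-reflexive (∑-0 {n}))

  cnt-∪ : (f g h : BoolFam n) → (∀ F → f ∋ F → g ∋ F ⊎ h ∋ F) → cnt f ≤ cnt g + cnt h
  cnt-∪ f g h cover = ≤-trans (∑-mono (λ F → pointwise (f F) (g F) (h F) (cover F)))
    (≤-reflexive (∑-+ (λ F → ⟦ g F ⟧) (λ F → ⟦ h F ⟧)))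
    where
    pointwise : ∀ a b c → (a ≡ true → b ≡ true ⊎ c ≡ true) → ⟦ a ⟧ ≤ ⟦ b ⟧ + ⟦ c ⟧
    pointwise false b     c     p = z≤n
    pointwise true  true  c     p = s≤s z≤n
    pointwise true  false true  p = ≤-refl
    pointwise true  false false p with p refl
    ... | inj₁ ()
    ... | inj₂ ()

  cnt-size : ∀ r p → cnt {r} (λ G → does (∣ G ∣ ≟ p)) ≤ r C p
  cnt-size zero    zero    = ≤-refl
  cnt-size zero    (suc p) = z≤n
  cnt-size (suc r) zero    = +-mono-≤
    (cnt-empty (λ (G : Subset r) → does (suc ∣ G ∣ ≟ 0)) (λ G p → absurd (true-does (suc ∣ G ∣ ≟ 0) p)))
    (cnt-size r zero)
    where
    absurd : ∀ {x} → suc x ≡ 0 → ⊥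
    absurd ()
  cnt-size (suc r) (suc p) = ≤-trans
    (+-mono-≤
      (≤-trans (cnt-mono {r} (λ G e → does-true (∣ G ∣ ≟ p) (suc-injective (true-does (suc ∣ G ∣ ≟ suc p) e))))
               (cnt-size r p))
      (cnt-size r (suc p)))
    (≤-reflexive (nCk+nC[k+1]≡[n+1]C[k+1] r p))

  traceEq traceGe : ℕ → ℕ → ℕ → BoolFam n
  traceEq M i s G = does (pre M G ≟ i) and does (∣ G ∣ ≟ s)
  traceGe M i s G = does (i ≤? pre M G) and does (∣ G ∣ ≟ s)

  traceGe-intro : ∀ M {i s} (G : Subset n) → i ≤ pre M G → ∣ G ∣ ≡ s → traceGe M i s ∋ G
  traceGe-intro M {i} {s} G p q = ∧-intro (does-true (i ≤? pre M G) p) (does-true (∣ G ∣ ≟ s) q)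

  traceEq-intro : ∀ M {i s} (G : Subset n) → pre M G ≡ i → ∣ G ∣ ≡ s → traceEq M i s ∋ G
  traceEq-intro M {i} {s} G p q = ∧-intro (does-true (pre M G ≟ i) p) (does-true (∣ G ∣ ≟ s) q)

  traceEq-elim : ∀ M i s (G : Subset n) → traceEq M i s ∋ G → pre M G ≡ i × ∣ G ∣ ≡ s
  traceEq-elim M i s G p = true-does (pre M G ≟ i) (proj₁ (∧-true p)) , true-does (∣ G ∣ ≟ s) (proj₂ (∧-true p))

  traceGe-elim : ∀ M i s (G : Subset n) → traceGe M i s ∋ G → i ≤ pre M G × ∣ G ∣ ≡ s
  traceGe-elim M i s G p = true-does (i ≤? pre M G) (proj₁ (∧-true p)) , true-does (∣ G ∣ ≟ s) (proj₂ (∧-true p))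

  cnt-traceEq : ∀ M r i p → cnt {M + r} (traceEq M i (i + p)) ≤ (M C i) * (r C p)
  cnt-traceEq zero r zero p = ≤-trans
    (cnt-mono {r} (λ G e → does-true (∣ G ∣ ≟ p) (proj₂ (traceEq-elim 0 0 p G e))))
    (≤-trans (cnt-size r p) (≤-reflexive (sym (*-identityˡ (r C p)))))
  cnt-traceEq zero r (suc i) p = ≤-trans
    (cnt-empty {r} (traceEq 0 (suc i) (suc i + p)) (λ G e → absurd (proj₁ (traceEq-elim 0 (suc i) _ G e)))) z≤n
    where
    absurd : ∀ {x} → 0 ≡ suc x → ⊥
    absurd ()
  cnt-traceEq (suc M) r zero p = +-mono-≤
    (cnt-empty {M + r} (λ G → traceEq (suc M) 0 p (true ∷ G)) (λ G e → absurd (proj₁ (traceEq-elim (suc M) 0 p (true ∷ G) e))))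
    (cnt-traceEq M r zero p)
    where
    absurd : ∀ {x} → suc x ≡ 0 → ⊥
    absurd ()
  cnt-traceEq (suc M) r (suc i) p = begin
    cnt (λ (G : Subset (M + r)) → traceEq (suc M) (suc i) (suc i + p) (true ∷ G))
      + cnt (λ (G : Subset (M + r)) → traceEq (suc M) (suc i) (suc i + p) (false ∷ G))
      ≤⟨ +-mono-≤ (cnt-mono ones) ≤-refl ⟩
    cnt {M + r} (traceEq M i (i + p)) + cnt {M + r} (traceEq M (suc i) (suc i + p))
      ≤⟨ +-mono-≤ (cnt-traceEq M r i p) (cnt-traceEq M r (suc i) p) ⟩
    (M C i) * (r C p) + (M C suc i) * (r C p)
      ≡⟨ *-distribʳ-+ (r C p) (M C i) (M C suc i) ⟨
    ((M C i) + (M C suc i)) * (r C p)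
      ≡⟨ cong (_* (r C p)) (nCk+nC[k+1]≡[n+1]C[k+1] M i) ⟩
    (suc M C suc i) * (r C p) ∎
    where
    open ≤-Reasoning
    ones : (λ (G : Subset (M + r)) → traceEq (suc M) (suc i) (suc i + p) (true ∷ G)) ⊑ traceEq M i (i + p)
    ones G e = let a , b = traceEq-elim (suc M) (suc i) (suc i + p) (true ∷ G) e in
      traceEq-intro M G (suc-injective a) (suc-injective b)

  traceGe-zero : ∀ M i → traceGe {n} M i (i + 0) ⊑ traceEq M i (i + 0)
  traceGe-zero M i G e = let a , b = traceGe-elim M i (i + 0) G e in
    traceEq-intro M G (≤-antisym (≤-trans (pre≤∣F∣ M G) (≤-reflexive (trans b (+-identityʳ i)))) a) b

  traceGe-suc : ∀ M i p (G : Subset n) → traceGe M i (i + suc p) ∋ G →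
                traceEq M i (i + suc p) ∋ G ⊎ traceGe M (suc i) (suc i + p) ∋ G
  traceGe-suc M i p G e with traceGe-elim M i (i + suc p) G e
  ... | a , b with m≤n⇒m<n∨m≡n a
  ...   | inj₁ lt = inj₂ (traceGe-intro M G lt (trans b (+-suc i p)))
  ...   | inj₂ eq = inj₁ (traceEq-intro M G (sym eq) b)

  C-tailSum : ℕ → ℕ → ℕ → ℕ
  C-tailSum M i zero    = M C i
  C-tailSum M i (suc p) = (M C i) + C-tailSum M (suc i) p

  -- In the application `R` is of order n and `X` is a constant multiple of the leading binomial
  -- coefficient, so the bound makes the tail smaller than the leading term by a factor of order n.
  cnt-traceGe : ∀ M r R X i p → (∀ p′ → p′ ≤ p → R * (r C p′) ≤ X) →
                R * cnt {M + r} (traceGe M i (i + p)) ≤ C-tailSum M i p * X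
  cnt-traceGe M r R X i p small = go i p small
    where
    open ≤-Reasoning
    swap : ∀ x y z → x * (y * z) ≡ y * (x * z)
    swap = solve-∀
    head : ∀ i p → R * (r C p) ≤ X → R * cnt {M + r} (traceEq M i (i + p)) ≤ (M C i) * X
    head i p le = begin
      R * cnt {M + r} (traceEq M i (i + p))  ≤⟨ *-monoʳ-≤ R (cnt-traceEq M r i p) ⟩
      R * ((M C i) * (r C p))        ≡⟨ swap R (M C i) (r C p) ⟩
      (M C i) * (R * (r C p))        ≤⟨ *-monoʳ-≤ (M C i) le ⟩
      (M C i) * X                    ∎
    go : ∀ i p → (∀ p′ → p′ ≤ p → R * (r C p′) ≤ X) →
         R * cnt {M + r} (traceGe M i (i + p)) ≤ C-tailSum M i p * X
    go i zero small = ≤-trans (*-monoʳ-≤ R (cnt-mono {M + r} (traceGe-zero M i))) (head i 0 (small 0 z≤n))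
    go i (suc p) small = begin
      R * cnt {M + r} (traceGe M i (i + suc p))
        ≤⟨ *-monoʳ-≤ R (cnt-∪ {M + r} _ (traceEq M i (i + suc p)) (traceGe M (suc i) (suc i + p)) (traceGe-suc M i p)) ⟩
      R * (cnt {M + r} (traceEq M i (i + suc p)) + cnt {M + r} (traceGe M (suc i) (suc i + p)))
        ≡⟨ *-distribˡ-+ R (cnt {M + r} (traceEq M i (i + suc p))) _ ⟩
      R * cnt {M + r} (traceEq M i (i + suc p)) + R * cnt {M + r} (traceGe M (suc i) (suc i + p))
        ≤⟨ +-mono-≤ (head i (suc p) (small (suc p) ≤-refl)) (go (suc i) p (λ p′ le → small p′ (m≤n⇒m≤1+n le))) ⟩
      (M C i) * X + C-tailSum M (suc i) p * X
        ≡⟨ *-distribʳ-+ X (M C i) (C-tailSum M (suc i) p) ⟨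
      C-tailSum M i (suc p) * X ∎

  -- The number of exceptional members

  C-mono : ∀ r p p′ → p′ ≤ p → p + p ≤ r → r C p′ ≤ r C p
  C-mono r zero    zero z≤n _  = ≤-refl
  C-mono r (suc p) p′   p′≤ 2p≤r with m≤n⇒m<n∨m≡n p′≤
  ... | inj₂ refl = ≤-refl
  ... | inj₁ (s≤s p′≤p) = ≤-trans (C-mono r p p′ p′≤p p+p≤r) (*-cancelˡ-≤ (suc p) (begin
    suc p * (r C p)      ≤⟨ *-monoˡ-≤ (r C p) 1+p≤r∸p ⟩
    (r ∸ p) * (r C p)    ≡⟨ [1+k]*nC[1+k] r p ⟨
    suc p * (r C suc p)  ∎))
    where
    open ≤-Reasoning
    p+p≤r : p + p ≤ r
    p+p≤r = ≤-trans (+-mono-≤ (n≤1+n p) (n≤1+n p)) 2p≤r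
    1+p≤r∸p : suc p ≤ r ∸ p
    1+p≤r∸p = m+n≤o⇒m≤o∸n (suc p) (≤-trans (+-monoʳ-≤ (suc p) (n≤1+n p)) 2p≤r)

  -- This is the case j = t, where γ(q, t, t) = 1 by the symmetry of the binomial coefficients C(t +
  -- 2q, q) and C(t + 2q, t + q).
  cnt≤cnt-del^ : ∀ t q (f : BoolFam n) → (∀ F → f ∋ F → Pseudo t q F) → cnt f ≤ cnt (del^ (window t q) t f)
  cnt≤cnt-del^ t q f ps = *-cancelʳ-≤ _ _ c {{C-nonZero (t+ℓ≤t+2ℓ q t)}}
    (subst (λ x → cnt f * x ≤ cnt (del^ (window t q) t f) * c) sym-C (cnt-del^-pseudo-γ q f ≤-refl ps))
    where
    c = (t + 2 * q) C (t + q)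
    sym-C : (t + 2 * q) C (t + q ∸ t) ≡ c
    sym-C = trans (cong ((t + 2 * q) C_) (trans (m+n∸m≡n t q) (sym (trans (cong (_∸ (t + q)) (eq t q)) (m+n∸m≡n (t + q) q)))))
                  (sym (nCk≡nC[n∸k] (t+ℓ≤t+2ℓ q t)))
      where
      eq : ∀ t q → t + 2 * q ≡ (t + q) + q
      eq = solve-∀

  -- In the t'th shadow inside [M] the sets have size q and at least `suc w` elements in [M]. Those
  -- with exactly `suc w` give the leading term; `E` counts those with more, which have fewer than p
  -- elements outside [M].
  largeTraces-bound : ∀ t w p → let q = suc w + p ; M = window t q in
    ∃[ c ] ∃[ N ] ∀ r → N ≤ M + r → (f : BoolFam (M + r)) → Uniform (t + q) f →
    (∀ F → f ∋ F → Pseudo t q F) → (∀ F → f ∋ F → suc w + t ≤ pre M F) →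
    ∃[ E ] cnt f ≤ (M C suc w) * (r C p) + E × suc (M + r) * E ≤ c * ((M C suc w) * (r C p))
  -- The bound on n forces r ≥ M + 2p. Then the coefficients C(r, i) increase up to i = p, and the
  -- factor gained from C(r, p - 1) to C(r, p) is of order n.
  largeTraces-bound t w p = constant p , M + (M + (p + p)) , λ r N≤ f un ps dense →
    E r p , ≤-trans (cnt≤cnt-del^ t q f ps) (≤-trans (cnt-mono (inTrace r f un dense)) (cover r p)) ,
    tail r p (+-cancelˡ-≤ M _ r N≤) 1≤C
    where
    open ≤-Reasoning
    q = suc w + p
    M = window t q
    1≤C : 1 ≤ M C suc w
    1≤C = n≢0⇒n>0 (≢-nonZero⁻¹ (M C suc w) {{C-nonZero (≤-trans (m≤m+n (suc w) p) (≤-trans (m≤m+n q t) (ℓ+s≤window t q)))}})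
    -- For p = 0 the size q equals `suc w` and no larger trace exists. Otherwise the 2 comes from n
    -- + 1 ≤ 2R, and the last factor from R C(r, p) = (p + 1) C(r, p + 1), with R = r - p.
    constant : ℕ → ℕ
    constant zero    = 0
    constant (suc p) = 2 * C-tailSum M (suc (suc w)) p * suc p
    E : ∀ r → ℕ → ℕ
    E r zero    = 0
    E r (suc p) = cnt {M + r} (traceGe M (suc (suc w)) (suc (suc w) + p))
    inTrace : ∀ r (f : BoolFam (M + r)) → Uniform (t + q) f → (∀ F → f ∋ F → suc w + t ≤ pre M F) →
              del^ M t f ⊑ traceGe M (suc w) q
    inTrace r f un dense G e = let F , F∈ , eq , size = del^-∋ M t f G e in
      traceGe-intro M G
        (+-cancelˡ-≤ t _ _ (begin
          t + suc w    ≡⟨ +-comm t (suc w) ⟩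
          suc w + t    ≤⟨ dense F F∈ ⟩
          pre M F      ≡⟨ eq ≤-refl ⟩
          t + pre M G  ∎))
        (+-cancelˡ-≡ t _ _ (trans (sym size) (un F F∈)))
    cover : ∀ r p → cnt {M + r} (traceGe M (suc w) (suc w + p)) ≤ (M C suc w) * (r C p) + E r p
    cover r zero    = ≤-trans (cnt-mono {M + r} (traceGe-zero M (suc w)))
      (≤-trans (cnt-traceEq M r (suc w) 0) (≤-reflexive (sym (+-identityʳ _))))
    cover r (suc p) = ≤-trans
      (cnt-∪ {M + r} _ (traceEq M (suc w) (suc w + suc p)) (traceGe M (suc (suc w)) (suc (suc w) + p)) (traceGe-suc M (suc w) p))
      (+-monoˡ-≤ (E r (suc p)) (cnt-traceEq M r (suc w) (suc p)))
    tail : ∀ r p → M + (p + p) ≤ r → 1 ≤ M C suc w → suc (M + r) * E r p ≤ constant p * ((M C suc w) * (r C p))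
    tail r zero    N≤ 1≤ = ≤-reflexive (*-zeroʳ (suc (M + r)))
    tail r (suc p) N≤ 1≤ = begin
      suc (M + r) * e                            ≤⟨ *-monoˡ-≤ e n≤2R ⟩
      2 * R * e                                  ≡⟨ *-assoc 2 R e ⟩
      2 * (R * e)                                ≤⟨ *-monoʳ-≤ 2 (cnt-traceGe M r R X (suc (suc w)) p small) ⟩
      2 * (K * X)                                ≡⟨ lemma K (suc p) (r C suc p) ⟩
      2 * K * suc p * (1 * (r C suc p))          ≤⟨ *-monoʳ-≤ (2 * K * suc p) (*-monoˡ-≤ (r C suc p) 1≤) ⟩
      2 * K * suc p * ((M C suc w) * (r C suc p)) ∎
      where
      e = E r (suc p)
      R = r ∸ p
      K = C-tailSum M (suc (suc w)) p
      X = suc p * (r C suc p)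
      lemma : ∀ K P x → 2 * (K * (P * x)) ≡ 2 * K * P * (1 * x)
      lemma = solve-∀
      2p≤r : suc p + suc p ≤ r
      2p≤r = ≤-trans (m≤n+m _ M) N≤
      p≤r : p ≤ r
      p≤r = ≤-trans (n≤1+n p) (≤-trans (m≤m+n (suc p) (suc p)) 2p≤r)
      small : ∀ p′ → p′ ≤ p → R * (r C p′) ≤ X
      small p′ le = begin
        R * (r C p′)  ≤⟨ *-monoʳ-≤ R (C-mono r p p′ le (≤-trans (+-mono-≤ (n≤1+n p) (n≤1+n p)) 2p≤r)) ⟩
        R * (r C p)   ≡⟨ [1+k]*nC[1+k] r p ⟨
        X             ∎
      n≤2R : suc (M + r) ≤ 2 * R
      n≤2R = +-cancelʳ-≤ (p + p) _ _ (begin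
        suc (M + r) + (p + p)        ≤⟨ n≤1+n _ ⟩
        suc (suc (M + r) + (p + p))  ≡⟨ lemma₁ M r p ⟩
        (M + (suc p + suc p)) + r    ≤⟨ +-monoˡ-≤ r N≤ ⟩
        r + r                        ≡⟨ cong (λ z → z + z) (m∸n+n≡m p≤r) ⟨
        (R + p) + (R + p)            ≡⟨ lemma₂ R p ⟩
        2 * R + (p + p)              ∎)
        where
        lemma₁ : ∀ M r p → suc (suc (M + r) + (p + p)) ≡ (M + (suc p + suc p)) + r
        lemma₁ = solve-∀
        lemma₂ : ∀ R p → (R + p) + (R + p) ≡ 2 * R + (p + p)
        lemma₂ = solve-∀

  -- The shadow of a stable family

  levelShadow : ℕ → BoolFam n → BoolFam n
  levelShadow i f = restrict (λ x → does (x ≟ i)) (below f)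

  del^-levelShadow : ∀ m j (f : BoolFam n) → Uniform k f → del^ m j f ⊑ levelShadow (k ∸ j) f
  del^-levelShadow {k = k} m j f un G e = ∧-intro
    (let F , F∈ , _ , size = del^-∋ m j f G e in
     does-true (∣ G ∣ ≟ k ∸ j)
       (sym (trans (cong (_∸ j) (trans (sym (un F F∈)) size)) (m+n∸m≡n j ∣ G ∣))))
    (del^-below m j f G e)

  -- From here on the theorem's w is `suc w` and k - t is `q`, so γ(w - 1, t + 1, j) is expressed
  -- without subtraction. The two shadow sizes stay separate numbers `S` and `S′`, to be weighed
  -- against each other only as rationals.
  stable-shadow : ∀ {t j} q w (f : BoolFam n) → j ≤ t → w < q →
    Stable f → CrossInt t 0 f f → Uniform (t + q) f →
    let Σf = cnt (levelShadow (t + q ∸ j) f)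
        hi = aboveThreshold (window t q) (suc (suc w) + t) f in
    (cnt f * ((t + 2 * suc w) C (t + suc w ∸ j)) ≤ Σf * ((t + 2 * suc w) C (t + suc w)))
    ⊎ ∃[ x ] ∃[ S ] ∃[ S′ ] cnt f ≡ x + cnt hi × S + S′ ≤ Σf
        × x * ((suc t + 2 * w) C (suc t + w ∸ j)) ≤ S * ((suc t + 2 * w) C (suc t + w))
        × cnt hi * ((t + 2 * q) C (t + q ∸ j)) ≤ S′ * ((t + 2 * q) C (t + q))
  stable-shadow {n} {t} {j} q w f j≤t w<q st ci un
    with anySubset? (λ F → (f F ≟ᵇ true) ×-dec ¬? (pseudo? t (suc w) F))
  ... | no none = inj₁ (≤-trans (cnt-del^-pseudo-γ (suc w) f j≤t pseudo)
        (*-monoˡ-≤ _ (cnt-mono (del^-levelShadow (window t (suc w)) j f un))))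
    where
    pseudo : ∀ F → f ∋ F → Pseudo t (suc w) F
    pseudo F F∈ = decidable-stable (pseudo? t (suc w) F) (λ ¬p → none (F , F∈ , ¬p))
  ... | yes (F₀ , F₀∈ , ¬p) = inj₂
    ( cnt lo , cnt (del^ m j lo) , cnt (del^ M j hi)
    , cnt-split f (λ F → does (pre M F <? a))
    , ≤-trans (cnt-del^-split j a f m≤M) (cnt-mono (del^-levelShadow M j f un))
    , cnt-del^-pseudo-γ w lo (m≤n⇒m≤1+n j≤t) lo-pseudo
    , cnt-del^-pseudo-γ q hi j≤t (λ F F∈ → stable-pseudo q st ci un F (proj₁ (∧-true F∈))))
    where
    a = suc (suc w) + t
    m = window (suc t) w
    M = window t q
    lo hi : BoolFam n
    lo = belowThreshold M a f
    hi = aboveThreshold M a f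
    m≤M : m ≤ M
    m≤M = subst₂ _≤_ (sym (window≡ (suc t) w)) (sym (window≡ t q)) (begin
      suc t + 2 * w      ≤⟨ n≤1+n _ ⟩
      suc (suc t + 2 * w) ≡⟨ eq t w ⟩
      t + 2 * suc w      ≤⟨ +-monoʳ-≤ t (*-monoʳ-≤ 2 w<q) ⟩
      t + 2 * q          ∎)
      where
      open ≤-Reasoning
      eq : ∀ t w → suc (suc t + 2 * w) ≡ t + 2 * suc w
      eq = solve-∀
    lo-pseudo : ∀ F → lo ∋ F → Pseudo (suc t) w F
    lo-pseudo F F∈ with pseudo-dichotomy q w st ci un F F₀ (proj₁ (∧-true F∈)) F₀∈
                          (≤-pred (true-does (pre M F <? a) (proj₂ (∧-true F∈))))
    ... | inj₁ ps = ps
    ... | inj₂ ps = ⊥-elim (¬p ps)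

  -- Families as lists and as Boolean predicates

  _≟ˢ_ : DecidableEquality (Subset n)
  _≟ˢ_ = ≡-dec _≟ᵇ_

  listFam : List (Subset n) → BoolFam n
  listFam xs F = does (DecMembership._∈?_ _≟ˢ_ F xs)

  listFam⁺ : ∀ {xs : List (Subset n)} {F} → F ∈ xs → listFam xs ∋ F
  listFam⁺ {xs = xs} {F} = does-true (DecMembership._∈?_ _≟ˢ_ F xs)

  listFam⁻ : ∀ {xs : List (Subset n)} {F} → listFam xs ∋ F → F ∈ xs
  listFam⁻ {xs = xs} {F} = true-does (DecMembership._∈?_ _≟ˢ_ F xs)

  single : Subset n → BoolFam n
  single []          []          = true
  single (true ∷ x)  (true ∷ F)  = single x F
  single (true ∷ x)  (false ∷ F) = false
  single (false ∷ x) (true ∷ F)  = false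
  single (false ∷ x) (false ∷ F) = single x F

  single⁺ : (x : Subset n) → single x ∋ x
  single⁺ []          = refl
  single⁺ (true ∷ x)  = single⁺ x
  single⁺ (false ∷ x) = single⁺ x

  single⁻ : (x F : Subset n) → single x ∋ F → F ≡ x
  single⁻ []          []          _ = refl
  single⁻ (true ∷ x)  (true ∷ F)  p = cong (true ∷_) (single⁻ x F p)
  single⁻ (false ∷ x) (false ∷ F) p = cong (false ∷_) (single⁻ x F p)

  cnt-single : (x : Subset n) → cnt (single x) ≡ 1
  cnt-single         []          = refl
  cnt-single {suc n} (true ∷ x)  = cong₂ _+_ (cnt-single x) (∑-0 {n})
  cnt-single {suc n} (false ∷ x) = cong₂ _+_ (∑-0 {n}) (cnt-single x)

  cnt-listFam : (xs : List (Subset n)) → Unique xs → cnt (listFam xs) ≡ length xs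
  cnt-listFam {n} []       []       = ∑-0 {n}
  cnt-listFam     (x ∷ xs) (x∉ ∷ u) = ≤-antisym
    (≤-trans (cnt-∪ (listFam (x ∷ xs)) (single x) (listFam xs) cover)
             (≤-reflexive (cong₂ _+_ (cnt-single x) (cnt-listFam xs u))))
    (≤-trans (≤-reflexive (cong₂ _+_ (sym (cnt-single x)) (sym (cnt-listFam xs u))))
             (cnt-disjoint {f = single x} {listFam xs} {listFam (x ∷ xs)}
               (λ F p → listFam⁺ {xs = x ∷ xs} (here (single⁻ x F p)))
               (λ F p → listFam⁺ {xs = x ∷ xs} (there (listFam⁻ {xs = xs} p)))
               (λ F p q → All¬⇒¬Any x∉ (subst (_∈ xs) (single⁻ x F p) (listFam⁻ {xs = xs} q)))))
    where
    cover : ∀ F → listFam (x ∷ xs) ∋ F → single x ∋ F ⊎ listFam xs ∋ F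
    cover F p with listFam⁻ {xs = x ∷ xs} p
    ... | here refl = inj₁ (single⁺ x)
    ... | there q   = inj₂ (listFam⁺ {xs = xs} q)

  below-∋ : (f : BoolFam n) → ∀ G → below f ∋ G → ∃[ F ] f ∋ F × G ⊆ F
  below-∋ f []          p = [] , p , ⊆-refl
  below-∋ f (true ∷ G)  p =
    let F , q , G⊆F = below-∋ (λ F → f (true ∷ F)) G p in true ∷ F , q , s⊆s G⊆F
  below-∋ f (false ∷ G) p with ∨-true p
  ... | inj₁ q = let F , r , G⊆F = below-∋ (λ F → f (true ∷ F)) G q in true ∷ F , r , out⊆ G⊆F
  ... | inj₂ q = let F , r , G⊆F = below-∋ (λ F → f (false ∷ F)) G q in false ∷ F , r , out⊆ G⊆F

  cnt-levelShadow≤card : ∀ j (𝓕 : Family n k) →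
                         cnt (levelShadow (k ∸ j) (listFam (members 𝓕))) ≤ card (shadow j 𝓕)
  cnt-levelShadow≤card {k = k} j 𝓕 = ≤-trans (cnt-mono inShadow)
    (≤-reflexive (cnt-listFam (members (shadow j 𝓕)) (unique (shadow j 𝓕))))
    where
    inShadow : levelShadow (k ∸ j) (listFam (members 𝓕)) ⊑ listFam (members (shadow j 𝓕))
    inShadow G p = let F , q , G⊆F = below-∋ (listFam (members 𝓕)) G (proj₂ (∧-true p)) in
      listFam⁺ (Equivalence.from (∈-shadow j 𝓕 G)
        (true-does (∣ G ∣ ≟ k ∸ j) (proj₁ (∧-true p)) , F , listFam⁻ {xs = members 𝓕} q , G⊆F))

  stableModel : ∀ {t} j (𝓕 : Family n k) → Intersecting t 𝓕 →
    ∃[ f ] Stable f × CrossInt t 0 f f × Uniform k f × cnt f ≡ card 𝓕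
         × cnt (levelShadow (k ∸ j) f) ≤ card (shadow j 𝓕)
  stableModel {k = k} j 𝓕 int =
    let f₀ = listFam (members 𝓕)
        f , st , r = stabilise f₀ in
    f , st
    , ⇝-crossInt r (λ F G p q → int F G (listFam⁻ {xs = members 𝓕} p) (listFam⁻ {xs = members 𝓕} q))
    , ⇝-uniform r (λ F p → All.lookup (uniform 𝓕) (listFam⁻ {xs = members 𝓕} p))
    , trans (⇝-cnt r) (cnt-listFam (members 𝓕) (unique 𝓕))
    , ≤-trans (⇝-below (λ x → does (x ≟ k ∸ j)) r) (cnt-levelShadow≤card j 𝓕)

  -- Rational arithmetic

  open import Data.Integer using (+_)

  -- Checked on unnormalised fractions, where sums and products involve no gcd; the next two lemmas
  -- take the same detour.
  ℕ→ℚ-+ : ∀ m n → ℕ→ℚ (m + n) ≡ ℕ→ℚ m ℚ.+ ℕ→ℚ n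
  ℕ→ℚ-+ m n = ℚ.toℚᵘ-injective (begin
    ℚ.toℚᵘ (ℕ→ℚ (m + n))                     ≈⟨ ℚ.toℚᵘ-fromℚᵘ (+ (m + n) ℚᵘ./ 1) ⟩
    + (m + n) ℚᵘ./ 1                          ≈⟨ ℚᵘ.*≡* (cong (ℤ._* + 1) (cong₂ ℤ._+_ (sym (ℤ.*-identityʳ (+ m))) (sym (ℤ.*-identityʳ (+ n))))) ⟩
    (+ m ℚᵘ./ 1) ℚᵘ.+ (+ n ℚᵘ./ 1)            ≈⟨ ℚᵘ.+-cong (ℚ.toℚᵘ-fromℚᵘ (+ m ℚᵘ./ 1)) (ℚ.toℚᵘ-fromℚᵘ (+ n ℚᵘ./ 1)) ⟨
    ℚ.toℚᵘ (ℕ→ℚ m) ℚᵘ.+ ℚ.toℚᵘ (ℕ→ℚ n)        ≈⟨ ℚ.toℚᵘ-homo-+ (ℕ→ℚ m) (ℕ→ℚ n) ⟨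
    ℚ.toℚᵘ (ℕ→ℚ m ℚ.+ ℕ→ℚ n)                  ∎)
    where open ℚᵘ.≃-Reasoning

  /-*-/ : ∀ a b c d .{{_ : NonZero b}} .{{_ : NonZero d}} .{{_ : NonZero (b * d)}} →
          (+ a / b) ℚ.* (+ c / d) ≡ + (a * c) / (b * d)
  /-*-/ a (suc b) c (suc d) = ℚ.toℚᵘ-injective (begin
    ℚ.toℚᵘ ((+ a / suc b) ℚ.* (+ c / suc d))            ≈⟨ ℚ.toℚᵘ-homo-* (+ a / suc b) (+ c / suc d) ⟩
    ℚ.toℚᵘ (+ a / suc b) ℚᵘ.* ℚ.toℚᵘ (+ c / suc d)      ≈⟨ ℚᵘ.*-cong (ℚ.toℚᵘ-fromℚᵘ (+ a ℚᵘ./ suc b)) (ℚ.toℚᵘ-fromℚᵘ (+ c ℚᵘ./ suc d)) ⟩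
    (+ a ℚᵘ./ suc b) ℚᵘ.* (+ c ℚᵘ./ suc d)              ≈⟨ ℚᵘ.*≡* (cong (ℤ._* + (suc b * suc d)) (sym (ℤ.pos-* a c))) ⟩
    + (a * c) ℚᵘ./ (suc b * suc d)                      ≈⟨ ℚ.toℚᵘ-fromℚᵘ (+ (a * c) ℚᵘ./ (suc b * suc d)) ⟨
    ℚ.toℚᵘ (+ (a * c) / (suc b * suc d))                ∎)
    where open ℚᵘ.≃-Reasoning

  /-cross-≤ : ∀ p q r s .{{_ : NonZero q}} .{{_ : NonZero s}} →
              p * s ≤ r * q → + p / q ℚ.≤ + r / s
  /-cross-≤ p (suc q) r (suc s) ps≤rq = ℚ.toℚᵘ-cancel-≤
    (ℚᵘ.≤-respʳ-≃ (ℚᵘ.≃-sym (ℚ.toℚᵘ-fromℚᵘ (+ r ℚᵘ./ suc s)))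
    (ℚᵘ.≤-respˡ-≃ (ℚᵘ.≃-sym (ℚ.toℚᵘ-fromℚᵘ (+ p ℚᵘ./ suc q)))
    (ℚᵘ.*≤* (subst₂ ℤ._≤_ (ℤ.pos-* p (suc s)) (ℤ.pos-* r (suc q)) (ℤ.+≤+ ps≤rq)))))

  ℕ→ℚ-* : ∀ m n → ℕ→ℚ (m * n) ≡ ℕ→ℚ m ℚ.* ℕ→ℚ n
  ℕ→ℚ-* m n = sym (/-*-/ m 1 n 1)

  ℕ→ℚ-mono : ∀ {m n} → m ≤ n → ℕ→ℚ m ℚ.≤ ℕ→ℚ n
  ℕ→ℚ-mono {m} {n} le = /-cross-≤ m 1 n 1 (*-monoˡ-≤ 1 le)

  ℕ→ℚ-nonNeg : ∀ m → 0ℚ ℚ.≤ ℕ→ℚ m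
  ℕ→ℚ-nonNeg m = ℕ→ℚ-mono {0} {m} z≤n

  /-*-≤ : ∀ a b x y .{{b≢0 : NonZero b}} → x * a ≤ y * b → (+ a / b) ℚ.* ℕ→ℚ x ℚ.≤ ℕ→ℚ y
  /-*-≤ a b x y {{b≢0}} le = subst (ℚ._≤ ℕ→ℚ y) (sym (/-*-/ a b x 1 {{b≢0}} {{_}} {{b1}}))
    (/-cross-≤ (a * x) (b * 1) y 1 {{b1}} (begin
      a * x * 1    ≡⟨ trans (*-identityʳ (a * x)) (*-comm a x) ⟩
      x * a        ≤⟨ le ⟩
      y * b        ≡⟨ cong (y *_) (*-identityʳ b) ⟨
      y * (b * 1)  ∎))
    where
    open ≤-Reasoning
    .b1 : NonZero (b * 1)
    b1 = m*n≢0 b 1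

  ≤-*-/ : ∀ a b x y .{{b≢0 : NonZero b}} → b * x ≤ a * y → ℕ→ℚ x ℚ.≤ (+ a / b) ℚ.* ℕ→ℚ y
  ≤-*-/ a b x y {{b≢0}} le = subst (ℕ→ℚ x ℚ.≤_) (sym (/-*-/ a b y 1 {{b≢0}} {{_}} {{b1}}))
    (/-cross-≤ x 1 (a * y) (b * 1) {{_}} {{b1}} (begin
      x * (b * 1)  ≡⟨ trans (cong (x *_) (*-identityʳ b)) (*-comm x b) ⟩
      b * x        ≤⟨ le ⟩
      a * y        ≡⟨ *-identityʳ (a * y) ⟨
      a * y * 1    ∎))
    where
    open ≤-Reasoning
    .b1 : NonZero (b * 1)
    b1 = m*n≢0 b 1

  c/[1+n]⟶0 : ∀ c → (λ n → + c / suc n) ⟶0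
  -- A positive δ is at least 1 over its denominator, so n ≥ c times that denominator suffices.
  c/[1+n]⟶0 c δ 0<δ = c * ℚ.↧ₙ δ , λ n N≤n → subst (ℚ._< δ) (sym (ℚ.0≤p⇒∣p∣≡p (nonNeg n))) (small δ 0<δ n N≤n)
    where
    nonNeg : ∀ n → 0ℚ ℚ.≤ + c / suc n
    nonNeg n = /-cross-≤ 0 1 c (suc n) z≤n
    small : ∀ δ → 0ℚ ℚ.< δ → ∀ n → c * ℚ.↧ₙ δ ≤ n → + c / suc n ℚ.< δ
    small δ@(ℚ.mkℚ (+ suc p) d-1 _) _ n N≤n = subst (+ c / suc n ℚ.<_) (ℚ.↥p/↧p≡p δ)
      (/-cross-< c (suc n) (suc p) (suc d-1) (≤-trans (s≤s N≤n) (m≤m+n (suc n) (p * suc n))))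
    small (ℚ.mkℚ (+ 0) _ _) (ℚ.*<* (ℤ.+<+ ()))
    small (ℚ.mkℚ ℤ.-[1+ _ ] _ _) (ℚ.*<* ())

  ÷-<-clear : ∀ T β y z c .{{_ : ℚ.NonZero β}} → 0ℚ ℚ.< β → (T ℚ.÷ β) ℚ.* y ℚ.* z ℚ.< c →
              T ℚ.* (y ℚ.* z) ℚ.< c ℚ.* β
  ÷-<-clear T β y z c 0<β lt = subst (ℚ._< c ℚ.* β) eq
    (ℚ.*-monoˡ-<-pos β {{ℚ.positive 0<β}} lt)
    where
    open ℚSolver.+-*-Solver
    eq : (T ℚ.* ℚ.1/ β) ℚ.* y ℚ.* z ℚ.* β ≡ T ℚ.* (y ℚ.* z)
    eq = trans
      (solve 5 (λ T i y z β → T :* i :* y :* z :* β := (T :* (y :* z)) :* (i :* β)) refl T (ℚ.1/ β) y z β)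
      (trans (cong (T ℚ.* (y ℚ.* z) ℚ.*_) (ℚ.*-inverseˡ β)) (ℚ.*-identityʳ _))

  -- With D = A − B the deficit of the h exceptional sets is at most D h, which
  -- the hypothesis on x + h bounds by the surplus A − G on all sets.
  combine : ∀ {A B G ε x h S S′ T Y E : ℚ} → 0ℚ ℚ.≤ x ℚ.+ h → 0ℚ ℚ.≤ h → G ℚ.≤ A →
    A ℚ.* x ℚ.≤ S → B ℚ.* h ℚ.≤ S′ → S ℚ.+ S′ ℚ.≤ T → h ℚ.≤ Y ℚ.+ E →
    (A ℚ.- B) ℚ.* E ℚ.≤ ε ℚ.* Y →
    ((A ℚ.- B) ℚ.+ ε) ℚ.* Y ℚ.≤ (x ℚ.+ h) ℚ.* (A ℚ.- G) →
    G ℚ.* (x ℚ.+ h) ℚ.≤ T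
  combine {A} {B} {G} {ε} {x} {h} {S} {S′} {T} {Y} {E} 0≤c 0≤h G≤A Ax≤S Bh≤S′ SS′≤T h≤ DE≤ main
    with ℚ.≤-total A B
  -- In this case the exceptional sets contribute at least the ratio A as well, and A ≥ G.
  ... | inj₁ A≤B = begin
    G ℚ.* (x ℚ.+ h)        ≤⟨ ℚ.*-monoʳ-≤-nonNeg (x ℚ.+ h) {{ℚ.nonNegative 0≤c}} G≤A ⟩
    A ℚ.* (x ℚ.+ h)        ≡⟨ ℚ.*-distribˡ-+ A x h ⟩
    A ℚ.* x ℚ.+ A ℚ.* h    ≤⟨ ℚ.+-mono-≤ Ax≤S (ℚ.≤-trans (ℚ.*-monoʳ-≤-nonNeg h {{ℚ.nonNegative 0≤h}} A≤B) Bh≤S′) ⟩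
    S ℚ.+ S′               ≤⟨ SS′≤T ⟩
    T                      ∎
    where open ℚ.≤-Reasoning
  ... | inj₂ B≤A = begin
    G ℚ.* (x ℚ.+ h)
      ≡⟨ solve 5 (λ A B G x h → G :* (x :+ h) := ((A :* x :+ B :* h) :+ (A :- B) :* h) :- (x :+ h) :* (A :- G)) refl A B G x h ⟩
    ((A ℚ.* x ℚ.+ B ℚ.* h) ℚ.+ D ℚ.* h) ℚ.- K
      ≤⟨ ℚ.+-monoˡ-≤ (ℚ.- K) (ℚ.+-monoʳ-≤ (A ℚ.* x ℚ.+ B ℚ.* h) Dh≤K) ⟩
    ((A ℚ.* x ℚ.+ B ℚ.* h) ℚ.+ K) ℚ.- K
      ≡⟨ solve 2 (λ a K → (a :+ K) :- K := a) refl (A ℚ.* x ℚ.+ B ℚ.* h) K ⟩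
    A ℚ.* x ℚ.+ B ℚ.* h
      ≤⟨ ℚ.+-mono-≤ Ax≤S Bh≤S′ ⟩
    S ℚ.+ S′
      ≤⟨ SS′≤T ⟩
    T ∎
    where
    open ℚ.≤-Reasoning
    open ℚSolver.+-*-Solver
    D = A ℚ.- B
    K = (x ℚ.+ h) ℚ.* (A ℚ.- G)
    0≤D : 0ℚ ℚ.≤ D
    0≤D = subst (ℚ._≤ D) (ℚ.+-inverseʳ B) (ℚ.+-monoˡ-≤ (ℚ.- B) B≤A)
    Dh≤K : D ℚ.* h ℚ.≤ K
    Dh≤K = begin
      D ℚ.* h                ≤⟨ ℚ.*-monoˡ-≤-nonNeg D {{ℚ.nonNegative 0≤D}} h≤ ⟩
      D ℚ.* (Y ℚ.+ E)        ≡⟨ ℚ.*-distribˡ-+ D Y E ⟩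
      D ℚ.* Y ℚ.+ D ℚ.* E    ≤⟨ ℚ.+-monoʳ-≤ (D ℚ.* Y) DE≤ ⟩
      D ℚ.* Y ℚ.+ ε ℚ.* Y    ≡⟨ ℚ.*-distribʳ-+ Y D ε ⟨
      (D ℚ.+ ε) ℚ.* Y        ≤⟨ main ⟩
      K                      ∎

  combine-counts : ∀ (A B G ε : ℚ) .{{_ : ℚ.NonZero (A ℚ.- G)}} (c x h S S′ T Y Z E : ℕ) →
    G ℚ.< A → c ≡ x + h → A ℚ.* ℕ→ℚ x ℚ.≤ ℕ→ℚ S → B ℚ.* ℕ→ℚ h ℚ.≤ ℕ→ℚ S′ → S + S′ ≤ T →
    h ≤ Y * Z + E → (A ℚ.- B) ℚ.* ℕ→ℚ E ℚ.≤ ε ℚ.* ℕ→ℚ (Y * Z) →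
    (((G ℚ.- B) ℚ.+ (A ℚ.- G)) ℚ.+ ε) ℚ.÷ (A ℚ.- G) ℚ.* ℕ→ℚ Y ℚ.* ℕ→ℚ Z ℚ.< ℕ→ℚ c →
    G ℚ.* ℕ→ℚ c ℚ.≤ ℕ→ℚ T
  combine-counts A B G ε c x h S S′ T Y Z E G<A c≡ Ax≤ Bh≤ SS′≤ h≤ DE≤ large =
    subst (λ z → G ℚ.* z ℚ.≤ ℕ→ℚ T) (sym c≡ℚ)
      (combine (subst (0ℚ ℚ.≤_) c≡ℚ (ℕ→ℚ-nonNeg c)) (ℕ→ℚ-nonNeg h) (ℚ.<⇒≤ G<A) Ax≤ Bh≤
        (subst (ℚ._≤ ℕ→ℚ T) (ℕ→ℚ-+ S S′) (ℕ→ℚ-mono SS′≤))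
        (subst (ℕ→ℚ h ℚ.≤_) (ℕ→ℚ-+ (Y * Z) E) (ℕ→ℚ-mono h≤))
        DE≤
        (ℚ.<⇒≤ (subst₂ ℚ._<_ (cong₂ ℚ._*_ regroup (sym (ℕ→ℚ-* Y Z))) (cong (ℚ._* (A ℚ.- G)) c≡ℚ) cleared)))
    where
    open ℚSolver.+-*-Solver
    c≡ℚ : ℕ→ℚ c ≡ ℕ→ℚ x ℚ.+ ℕ→ℚ h
    c≡ℚ = trans (cong ℕ→ℚ c≡) (ℕ→ℚ-+ x h)
    0<β : 0ℚ ℚ.< A ℚ.- G
    0<β = subst (ℚ._< A ℚ.- G) (ℚ.+-inverseʳ G) (ℚ.+-monoˡ-< (ℚ.- G) G<A)
    cleared : (((G ℚ.- B) ℚ.+ (A ℚ.- G)) ℚ.+ ε) ℚ.* (ℕ→ℚ Y ℚ.* ℕ→ℚ Z) ℚ.< ℕ→ℚ c ℚ.* (A ℚ.- G)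
    cleared = ÷-<-clear (((G ℚ.- B) ℚ.+ (A ℚ.- G)) ℚ.+ ε) (A ℚ.- G) (ℕ→ℚ Y) (ℕ→ℚ Z) (ℕ→ℚ c) 0<β large
    -- This is α + β = A - B: the ratio G cancels.
    regroup : ((G ℚ.- B) ℚ.+ (A ℚ.- G)) ℚ.+ ε ≡ (A ℚ.- B) ℚ.+ ε
    regroup = cong (ℚ._+ ε) (solve 3 (λ A B G → (G :- B) :+ (A :- G) := A :- B) refl A B G)

  -- From counts to the asymptotic statement

  γ-nonNeg : ∀ ℓ t j → 0ℚ ℚ.≤ γ ℓ t j
  γ-nonNeg ℓ t j = /-cross-≤ 0 1 ((t + 2 * ℓ) C (t + ℓ ∸ j)) ((t + 2 * ℓ) C (t + ℓ)) {{_}} {{C-nonZero (t+ℓ≤t+2ℓ ℓ t)}} z≤n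

  γ-*-≤ : ∀ ℓ t j x y → x * ((t + 2 * ℓ) C (t + ℓ ∸ j)) ≤ y * ((t + 2 * ℓ) C (t + ℓ)) →
          γ ℓ t j ℚ.* ℕ→ℚ x ℚ.≤ ℕ→ℚ y
  γ-*-≤ ℓ t j x y = /-*-≤ ((t + 2 * ℓ) C (t + ℓ ∸ j)) ((t + 2 * ℓ) C (t + ℓ)) x y {{C-nonZero (t+ℓ≤t+2ℓ ℓ t)}}

  γ≤numerator : ∀ ℓ t j → γ ℓ t j ℚ.≤ ℕ→ℚ ((t + 2 * ℓ) C (t + ℓ ∸ j))
  γ≤numerator ℓ t j = /-cross-≤ a b a 1 (*-monoʳ-≤ a (>-nonZero⁻¹ b))
    where
    a = (t + 2 * ℓ) C (t + ℓ ∸ j)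
    b = (t + 2 * ℓ) C (t + ℓ)
    instance
      b≢0 : NonZero b
      b≢0 = C-nonZero (t+ℓ≤t+2ℓ ℓ t)

  -- The origin of ε: the error `E` is at most c / (n + 1) times the leading term, and A - B ≤ A ≤ a
  -- for a natural number `a`, so ε(n) = a c / (n + 1) pays for it.
  γ-difference-*-≤ : ∀ {A B : ℚ} a c n E Y → A ℚ.≤ ℕ→ℚ a → 0ℚ ℚ.≤ B → suc n * E ≤ c * Y →
                     (A ℚ.- B) ℚ.* ℕ→ℚ E ℚ.≤ (+ (a * c) / suc n) ℚ.* ℕ→ℚ Y
  γ-difference-*-≤ {A} {B} a c n E Y A≤a 0≤B nE≤cY = begin
    (A ℚ.- B) ℚ.* ℕ→ℚ E  ≤⟨ ℚ.*-monoʳ-≤-nonNeg (ℕ→ℚ E) {{ℚ.nonNegative (ℕ→ℚ-nonNeg E)}} A-B≤a ⟩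
    ℕ→ℚ a ℚ.* ℕ→ℚ E      ≡⟨ ℕ→ℚ-* a E ⟨
    ℕ→ℚ (a * E)          ≤⟨ ≤-*-/ (a * c) (suc n) (a * E) Y le ⟩
    (+ (a * c) / suc n) ℚ.* ℕ→ℚ Y ∎
    where
    open ℚ.≤-Reasoning
    A-B≤a : A ℚ.- B ℚ.≤ ℕ→ℚ a
    A-B≤a = ℚ.≤-trans (ℚ.+-mono-≤ A≤a (ℚ.neg-antimono-≤ 0≤B)) (ℚ.≤-reflexive (ℚ.+-identityʳ (ℕ→ℚ a)))
    lemma : ∀ n a E → n * (a * E) ≡ a * (n * E)
    lemma = solve-∀
    le : suc n * (a * E) ≤ a * c * Y
    le = ≤-trans (≤-reflexive (lemma (suc n) a E))
           (≤-trans (*-monoʳ-≤ a nE≤cY) (≤-reflexive (sym (*-assoc a c Y))))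

  -- The result of the counting, in natural numbers and in terms of `size` and `sh` alone, so that
  -- it can be carried from the stable model to the original family.
  data Outcome (t j w p c r size sh : ℕ) : Set where
    oneWindow : size * ((t + 2 * suc w) C (t + suc w ∸ j)) ≤ sh * ((t + 2 * suc w) C (t + suc w)) →
                Outcome t j w p c r size sh
    twoParts  : ∀ x h S S′ E → size ≡ x + h → S + S′ ≤ sh →
                let q = suc (suc w) + p ; M = window t q ; Y = (M C suc (suc w)) * (r C p) in
                x * ((suc t + 2 * w) C (suc t + w ∸ j)) ≤ S * ((suc t + 2 * w) C (suc t + w)) →
                h * ((t + 2 * q) C (t + q ∸ j)) ≤ S′ * ((t + 2 * q) C (t + q)) →
                h ≤ Y + E → suc (M + r) * E ≤ c * Y →
                Outcome t j w p c r size sh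

  stable-outcome : ∀ t j w p → j ≤ t → let q = suc (suc w) + p ; M = window t q in
    ∃[ c ] ∃[ N ] ∀ r → N ≤ M + r → (f : BoolFam (M + r)) →
    Stable f → CrossInt t 0 f f → Uniform (t + q) f →
    Outcome t j w p c r (cnt f) (cnt (levelShadow (t + q ∸ j) f))
  stable-outcome t j w p j≤t = c , N , outcome
    where
    q = suc (suc w) + p
    M = window t q
    a = suc (suc w) + t
    tail = largeTraces-bound t (suc w) p
    c = proj₁ tail
    N = proj₁ (proj₂ tail)
    outcome : ∀ r → N ≤ M + r → (f : BoolFam (M + r)) →
      Stable f → CrossInt t 0 f f → Uniform (t + q) f →
      Outcome t j w p c r (cnt f) (cnt (levelShadow (t + q ∸ j) f))
    outcome r N≤ f st ci un = Sum.[ oneWindow , parts ]′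
      (stable-shadow q w f j≤t (s≤s (m≤n⇒m≤1+n (m≤m+n w p))) st ci un)
      where
      hi : BoolFam (M + r)
      hi = aboveThreshold M a f
      few = proj₂ (proj₂ tail) r N≤ hi (λ F F∈ → un F (proj₁ (∧-true F∈)))
        (λ F F∈ → stable-pseudo q st ci un F (proj₁ (∧-true F∈)))
        (λ F F∈ → ≮⇒≥ (not-does (pre M F <? a) (proj₂ (∧-true F∈))))
      parts : _ → Outcome t j w p c r (cnt f) (cnt (levelShadow (t + q ∸ j) f))
      parts (x , S , S′ , split , SS′≤ , x≤ , h≤) =
        twoParts x (cnt hi) S S′ (proj₁ few) split SS′≤ x≤ h≤ (proj₁ (proj₂ few)) (proj₂ (proj₂ few))

  weaken-outcome : ∀ {t j w p c r size sh size′ sh′} → size ≡ size′ → sh ≤ sh′ →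
                   Outcome t j w p c r size sh → Outcome t j w p c r size′ sh′
  weaken-outcome refl le (oneWindow p) = oneWindow (≤-trans p (*-monoˡ-≤ _ le))
  weaken-outcome refl le (twoParts x h S S′ E split SS′≤ x≤ h≤ few tiny) =
    twoParts x h S S′ E split (≤-trans SS′≤ le) x≤ h≤ few tiny

  family-outcome : ∀ t j w p → j ≤ t → let q = suc (suc w) + p ; M = window t q in
    ∃[ c ] ∃[ N ] ∀ r → N ≤ M + r → (𝓕 : Family (M + r) (t + q)) → Intersecting t 𝓕 →
    Outcome t j w p c r (card 𝓕) (card (shadow j 𝓕))
  family-outcome t j w p j≤t =
    let c , N , outcome = stable-outcome t j w p j≤t in
    c , N , λ r N≤ 𝓕 int → viaModel {𝓕 = 𝓕} (outcome r N≤) (stableModel j 𝓕 int)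
    where
    q = suc (suc w) + p
    viaModel : ∀ {c r} {𝓕 : Family (window t q + r) (t + q)} →
      (∀ (f : BoolFam (window t q + r)) → Stable f → CrossInt t 0 f f → Uniform (t + q) f →
        Outcome t j w p c r (cnt f) (cnt (levelShadow (t + q ∸ j) f))) →
      (Σ[ f ∈ BoolFam (window t q + r) ] Stable f × CrossInt t 0 f f × Uniform (t + q) f × cnt f ≡ card 𝓕
         × cnt (levelShadow (t + q ∸ j) f) ≤ card (shadow j 𝓕)) →
      Outcome t j w p c r (card 𝓕) (card (shadow j 𝓕))
    viaModel outcome (f , st , ci , un , size , Σf≤) =
      weaken-outcome {size = cnt f} {cnt (levelShadow (t + q ∸ j) f)} size Σf≤ (outcome f st ci un)

  -- The ground set has size `window t q + r`, where the window is [2k - t]; its complement has r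
  -- elements, and the outer binomial coefficient is C(r, p) without any subtraction.
  shadow-bound : ∀ t j w p → (1≤j : 1 ≤ j) (j<t : j < t) →
    let q = suc (suc w) + p
        A = γ w (suc t) j
        B = γ q t j
        G = γ (suc w) t j in
    ∃[ ε ] (ε ⟶0) × (∃[ N ] ∀ r → N ≤ window t q + r →
      (𝓕 : Family (window t q + r) (t + q)) → Intersecting t 𝓕 →
      ((((G ℚ.- B) ℚ.+ (A ℚ.- G)) ℚ.+ ε (window t q + r)) ℚ.÷ (A ℚ.- G)) {{β-nonZero {suc w} (s≤s z≤n) 1≤j j<t}}
        ℚ.* ℕ→ℚ (window t q C suc (suc w)) ℚ.* ℕ→ℚ (r C p) ℚ.< ℕ→ℚ (card 𝓕) →
      G ℚ.* ℕ→ℚ (card 𝓕) ℚ.≤ ℕ→ℚ (card (shadow j 𝓕)))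
  shadow-bound t j w p 1≤j j<t = ε , c/[1+n]⟶0 (a * c) , proj₁ (proj₂ out) ,
    λ r N≤ 𝓕 int → conclude r 𝓕 (proj₂ (proj₂ out) r N≤ 𝓕 int)
    where
    q = suc (suc w) + p
    M = window t q
    Y = M C suc (suc w)
    a = (suc t + 2 * w) C (suc t + w ∸ j)
    out = family-outcome t j w p (<⇒≤ j<t)
    c = proj₁ out
    ε : ℕ → ℚ
    ε n = + (a * c) / suc n
    conclude : ∀ r (𝓕 : Family (M + r) (t + q)) →
      Outcome t j w p c r (card 𝓕) (card (shadow j 𝓕)) →
      ((((γ (suc w) t j ℚ.- γ q t j) ℚ.+ (γ w (suc t) j ℚ.- γ (suc w) t j)) ℚ.+ ε (M + r))
        ℚ.÷ (γ w (suc t) j ℚ.- γ (suc w) t j)) {{β-nonZero {suc w} (s≤s z≤n) 1≤j j<t}}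
        ℚ.* ℕ→ℚ Y ℚ.* ℕ→ℚ (r C p) ℚ.< ℕ→ℚ (card 𝓕) →
      γ (suc w) t j ℚ.* ℕ→ℚ (card 𝓕) ℚ.≤ ℕ→ℚ (card (shadow j 𝓕))
    conclude r 𝓕 (oneWindow le) large = γ-*-≤ (suc w) t j (card 𝓕) (card (shadow j 𝓕)) le
    conclude r 𝓕 (twoParts x h S S′ E split SS′≤ x≤ h≤ few tiny) large =
      combine-counts (γ w (suc t) j) (γ q t j) (γ (suc w) t j) (ε (M + r))
        {{β-nonZero {suc w} (s≤s z≤n) 1≤j j<t}}
        (card 𝓕) x h S S′ (card (shadow j 𝓕)) Y (r C p) E
        (γ-step (suc w) t j (s≤s z≤n) 1≤j j<t)
        split (γ-*-≤ w (suc t) j x S x≤) (γ-*-≤ q t j h S′ h≤) SS′≤ few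
        (γ-difference-*-≤ a c (M + r) E (Y * (r C p)) (γ≤numerator w (suc t) j) (γ-nonNeg q t j) tiny)
        large

  -- Translation into truncated differences

  2[t+q]∸t : ∀ t q → 2 * (t + q) ∸ t ≡ window t q
  2[t+q]∸t t q = trans (cong (_∸ t) (eq t q)) (trans (m+n∸m≡n t (t + 2 * q)) (sym (window≡ t q)))
    where
    eq : ∀ t q → 2 * (t + q) ≡ t + (t + 2 * q)
    eq = solve-∀

  -- The condition t ≤ r says n ≥ 2k, so the inner difference is a true one and adding t recovers r.
  window+r∸2[t+q]+t : ∀ t q r → t ≤ r → window t q + r ∸ 2 * (t + q) + t ≡ r
  window+r∸2[t+q]+t t q r t≤r = begin
    window t q + r ∸ 2 * (t + q) + t                ≡⟨ cong₂ (λ x y → x + y ∸ 2 * (t + q) + t) (window≡ t q) (sym (m+[n∸m]≡n t≤r)) ⟩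
    (t + 2 * q) + (t + (r ∸ t)) ∸ 2 * (t + q) + t   ≡⟨ cong (λ x → x ∸ 2 * (t + q) + t) (eq t q (r ∸ t)) ⟩
    2 * (t + q) + (r ∸ t) ∸ 2 * (t + q) + t         ≡⟨ cong (_+ t) (m+n∸m≡n (2 * (t + q)) (r ∸ t)) ⟩
    (r ∸ t) + t                                     ≡⟨ m∸n+n≡m t≤r ⟩
    r                                               ∎
    where
    open ≡-Reasoning
    eq : ∀ t q d → (t + 2 * q) + (t + d) ≡ 2 * (t + q) + d
    eq = solve-∀

  k∸w∸t∸1 : ∀ k w t → k ∸ suc w ∸ t ∸ 1 ≡ k ∸ t ∸ suc (suc w)
  k∸w∸t∸1 k w t = begin
    k ∸ suc w ∸ t ∸ 1      ≡⟨ cong (_∸ 1) (∸-+-assoc k (suc w) t) ⟩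
    k ∸ (suc w + t) ∸ 1    ≡⟨ ∸-+-assoc k (suc w + t) 1 ⟩
    k ∸ (suc w + t + 1)    ≡⟨ cong (k ∸_) (eq w t) ⟩
    k ∸ (t + suc (suc w))  ≡⟨ ∸-+-assoc k t (suc (suc w)) ⟨
    k ∸ t ∸ suc (suc w)    ∎
    where
    open ≡-Reasoning
    eq : ∀ w t → suc w + t + 1 ≡ t + suc (suc w)
    eq = solve-∀

  -- The parameters d, e, v, p′ and the function z stand for the truncated
  -- differences in which the theorem is phrased.
  shadow-bound-∸ : ∀ t j w p k d e v p′ (z : ℕ → ℕ) (1≤j : 1 ≤ j) (j<t : j < t) →
    let q = suc (suc w) + p in
    k ≡ t + q → d ≡ q → e ≡ window t q → v ≡ suc (suc w) → p′ ≡ p →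
    (∀ r → t ≤ r → z (window t q + r) ≡ r) →
    ∃[ ε ] (ε ⟶0) × (∃[ N ] ∀ n → N ≤ n → (𝓕 : Family n k) → Intersecting t 𝓕 →
      ((((γ (suc w) t j ℚ.- γ d t j) ℚ.+ (γ w (suc t) j ℚ.- γ (suc w) t j)) ℚ.+ ε n)
          ℚ.÷ (γ w (suc t) j ℚ.- γ (suc w) t j)) {{β-nonZero {suc w} (s≤s z≤n) 1≤j j<t}}
        ℚ.* ℕ→ℚ (e C v) ℚ.* ℕ→ℚ (z n C p′) ℚ.< ℕ→ℚ (card 𝓕) →
      γ (suc w) t j ℚ.* ℕ→ℚ (card 𝓕) ℚ.≤ ℕ→ℚ (card (shadow j 𝓕)))
  shadow-bound-∸ t j w p _ _ _ _ _ z 1≤j j<t refl refl refl refl refl z≡ =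
    -- Since M + t = 2k, the second bound keeps n - 2k from being truncated.
    ε , proj₁ (proj₂ base) , N ⊔ (M + t) ,
    λ n N≤n → atLevel n (n ∸ M) (sym (m+[n∸m]≡n (≤-trans (m≤m+n M t) (≤-trans (m≤n⊔m N (M + t)) N≤n)))) N≤n
    where
    q = suc (suc w) + p
    M = window t q
    base = shadow-bound t j w p 1≤j j<t
    ε = proj₁ base
    N = proj₁ (proj₂ (proj₂ base))
    factor : ℕ → ℚ
    factor n = ((((γ (suc w) t j ℚ.- γ q t j) ℚ.+ (γ w (suc t) j ℚ.- γ (suc w) t j)) ℚ.+ ε n)
      ℚ.÷ (γ w (suc t) j ℚ.- γ (suc w) t j)) {{β-nonZero {suc w} (s≤s z≤n) 1≤j j<t}} ℚ.* ℕ→ℚ (M C suc (suc w))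
    atLevel : ∀ n r → n ≡ M + r → N ⊔ (M + t) ≤ n → (𝓕 : Family n (t + q)) → Intersecting t 𝓕 →
      factor n ℚ.* ℕ→ℚ (z n C p) ℚ.< ℕ→ℚ (card 𝓕) →
      γ (suc w) t j ℚ.* ℕ→ℚ (card 𝓕) ℚ.≤ ℕ→ℚ (card (shadow j 𝓕))
    atLevel _ r refl N≤n 𝓕 int large = proj₂ (proj₂ (proj₂ base)) r (≤-trans (m≤m⊔n N (M + t)) N≤n) 𝓕 int
      (subst (λ y → factor (M + r) ℚ.* ℕ→ℚ (y C p) ℚ.< ℕ→ℚ (card 𝓕))
        (z≡ r (+-cancelˡ-≤ M t r (≤-trans (m≤n⊔m N (M + t)) N≤n))) large)

open import Data.Rational using (_+_; _-_; _*_; _÷_)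

theorem7p3 :
  (k t j w : ℕ) →
  (1≤j : 1 ≤ j) → (j<t : j < t) → t < k → (1≤w : 1 ≤ w) → w < k ∸ t →
  let α = γ w t j - γ (k ∸ t) t j
      β = γ (w ∸ 1) (suc t) j - γ w t j
  in
  ∃[ ε ] (ε ⟶0) × (∃[ N ] ∀ n → N ≤ n → (𝓕 : Family n k) → Intersecting t 𝓕 →
    (((α + β + ε n) ÷ β) {{β-nonZero 1≤w 1≤j j<t}}
      * ℕ→ℚ ((2 ℕ.* k ∸ t) C (w ℕ.+ 1))
      * ℕ→ℚ ((n ∸ 2 ℕ.* k ℕ.+ t) C (k ∸ w ∸ t ∸ 1))) ℚ.< ℕ→ℚ (card 𝓕) →
    γ w t j * ℕ→ℚ (card 𝓕) ℚ.≤ ℕ→ℚ (card (shadow j 𝓕)))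
theorem7p3 k t j (suc w) 1≤j j<t t<k 1≤w w<k∸t =
  shadow-bound-∸ t j w p k (k ∸ t) (2 ℕ.* k ∸ t) (suc w ℕ.+ 1) (k ∸ suc w ∸ t ∸ 1) (λ n → n ∸ 2 ℕ.* k ℕ.+ t)
    1≤j j<t k≡ d≡ (subst (λ k → 2 ℕ.* k ∸ t ≡ window t q) (sym k≡) (2[t+q]∸t t q))
    (ℕ.+-comm (suc w) 1) (k∸w∸t∸1 k w t)
    (subst (λ k → ∀ r → t ≤ r → window t q ℕ.+ r ∸ 2 ℕ.* k ℕ.+ t ≡ r) (sym k≡) (window+r∸2[t+q]+t t q))
  where
  -- The number of elements outside [2k - t] in the leading term; `w<k∸t` says that this difference
  -- is not truncated.
  p = k ∸ t ∸ suc (suc w)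
  q = suc (suc w) ℕ.+ p
  d≡ : k ∸ t ≡ q
  d≡ = sym (ℕ.m+[n∸m]≡n w<k∸t)
  k≡ : k ≡ t ℕ.+ q
  k≡ = trans (sym (ℕ.m+[n∸m]≡n (ℕ.<⇒≤ t<k))) (cong (t ℕ.+_) d≡)
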